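{- Let $G$ be a connected cograph on $n$ vertices with cotree $T_G$ having $r$ interior vertices $w_1,\dots,w_r$, where $w_1$ is the root of $T_G$. For each $i$, let $s_i$ be the number of children of $w_i$ that are interior vertices and $t_i$ the number of children of $w_i$ that are leaves. Then the number of spanning trees of $G$ equals $$\prod_{i=2}^{r}\delta(w_i)^{\,s_i+t_i-1}\cdot n^{\,s_1+t_1-2},$$ where $\delta(w_i)$ is the degree of the interior vertex $w_i$.
   Context: A cograph is a graph with no induced path on four vertices. The cotree $T_G$ of a cograph $G$ is the rooted tree whose leaves are the vertices of $G$, whose interior vertices are each labelled $\cup$ or $\otimes$, every interior vertex having at least two children, with labels alternating along every root-to-leaf path (root of type $\otimes$ when $G$ is connected), and such that two vertices of $G$ are adjacent iff their least common ancestor in $T_G$ is of $\otimes$-type. For interior vertices $w_i,w_j$, $lca(w_i,w_j)$ denotes their least common ancestor (with $lca(w_j,w_j)=w_j$). The degree of an interior vertex $w_j$ is $\delta(w_j)=$ the number of leaves $v$ of $T_G$ whose parent $w_i$ satisfies that $lca(w_i,w_j)$ is of $\otimes$-type. A spanning tree of a connected graph on $n$ vertices is a connected subgraph with all $n$ vertices and $n-1$ edges. -}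

module Defs where

open import Data.Nat using (ℕ; zero; suc; _+_; _*_; _∸_; _^_; _≤_; _≡ᵇ_)
open import Data.Bool using (Bool; true; false; if_then_else_)
open import Data.List using (List; []; _∷_; [_]; _++_; map; length; drop; filterᵇ)
open import Data.Nat.ListAction using (product)
open import Data.List.Relation.Unary.All using (All)
open import Data.List.Relation.Unary.Unique.Propositional using (Unique)
open import Data.List.Membership.Propositional using (_∈_)
open import Data.Maybe using (Maybe; just; nothing)
open import Data.Fin using (Fin)
open import Data.Vec using (Vec; lookup)
open import Data.Unit using (⊤)
open import Data.Product using (Σ; _×_; ∃)
open import Function.Bundles using (_⇔_)
open import Relation.Binary.PropositionalEquality using (_≡_; _≢_)
open import Relation.Binary.Construct.Closure.ReflexiveTransitive using (Star)

data Label : Set where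
  union join : Label

data Cotree : Set where
  leaf : Cotree
  node : Label → List Cotree → Cotree

AltChild : Label → Cotree → Set
AltChild l leaf = ⊤
AltChild l (node l' _) = l' ≢ l

data WellFormed : Cotree → Set where
  leafWF : WellFormed leaf
  nodeWF : ∀ {l cs} → 2 ≤ length cs → All (AltChild l) cs → All WellFormed cs →
           WellFormed (node l cs)

-- vertices of the cotree are addressed by paths (sequences of child indices)
Path : Set
Path = List ℕ

mutual
  subtreeAt : Cotree → Path → Maybe Cotree
  subtreeAt t [] = just t
  subtreeAt leaf (_ ∷ _) = nothing
  subtreeAt (node _ cs) (k ∷ p) = subtreeAtF cs k p

  subtreeAtF : List Cotree → ℕ → Path → Maybe Cotree
  subtreeAtF [] _ _ = nothing
  subtreeAtF (c ∷ cs) zero p = subtreeAt c p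
  subtreeAtF (c ∷ cs) (suc k) p = subtreeAtF cs k p

labelAt : Cotree → Path → Maybe Label
labelAt t p with subtreeAt t p
... | just (node l _) = just l
... | _ = nothing

numChildren : Cotree → Path → ℕ
numChildren t p with subtreeAt t p
... | just (node _ cs) = length cs
... | _ = 0

mutual
  leavesT : Cotree → List Path
  leavesT leaf = [ [] ]
  leavesT (node _ cs) = leavesF 0 cs

  leavesF : ℕ → List Cotree → List Path
  leavesF k [] = []
  leavesF k (c ∷ cs) = map (k ∷_) (leavesT c) ++ leavesF (suc k) cs

mutual
  interiorsT : Cotree → List Path
  interiorsT leaf = []
  interiorsT (node _ cs) = [] ∷ interiorsF 0 cs

  interiorsF : ℕ → List Cotree → List Path
  interiorsF k [] = []
  interiorsF k (c ∷ cs) = map (k ∷_) (interiorsT c) ++ interiorsF (suc k) cs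

nonRootInteriors : Cotree → List Path
nonRootInteriors t = drop 1 (interiorsT t)

-- least common ancestor = longest common prefix of paths
lca : Path → Path → Path
lca (a ∷ p) (b ∷ q) = if a ≡ᵇ b then a ∷ lca p q else []
lca _ _ = []

parent : Path → Path
parent [] = []
parent (a ∷ []) = []
parent (a ∷ b ∷ p) = a ∷ parent (b ∷ p)

isJoin : Maybe Label → Bool
isJoin (just join) = true
isJoin _ = false

δ : Cotree → Path → ℕ
δ t w = length (filterᵇ (λ v → isJoin (labelAt t (lca (parent v) w))) (leavesT t))

nV : Cotree → ℕ
nV t = length (leavesT t)

vtx : (t : Cotree) → Fin (nV t) → Path
vtx t i = Data.List.lookup (leavesT t) i

Adj : (t : Cotree) → Fin (nV t) → Fin (nV t) → Set
Adj t i j = i ≢ j × labelAt t (lca (vtx t i) (vtx t j)) ≡ just join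

-- Spanning trees of a graph on Fin n, given by an adjacency relation.
-- A spanning subgraph is given by its adjacency matrix H.

Edge : ∀ {n} → Vec (Vec Bool n) n → Fin n → Fin n → Set
Edge H i j = lookup (lookup H i) j ≡ true

trues : ∀ {m} → Vec Bool m → ℕ
trues Data.Vec.[] = 0
trues (true Data.Vec.∷ v) = suc (trues v)
trues (false Data.Vec.∷ v) = trues v

-- number of true entries of the matrix (= twice the number of edges when symmetric)
entries : ∀ {n m} → Vec (Vec Bool n) m → ℕ
entries Data.Vec.[] = 0
entries (r Data.Vec.∷ H) = trues r + entries H

record IsSpanningTree (n : ℕ) (A : Fin n → Fin n → Set) (H : Vec (Vec Bool n) n) : Set where
  field
    subgraph  : ∀ i j → Edge H i j → A i j
    symmetric : ∀ i j → Edge H i j → Edge H j i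
    edgeCount : entries H ≡ 2 * (n ∸ 1)
    connected : ∀ i j → Star (Edge H) i j

HasCardinality : {X : Set} → (X → Set) → ℕ → Set
HasCardinality {X} P N =
  Σ (List X) λ L → Unique L × (∀ x → (x ∈ L) ⇔ P x) × length L ≡ N

NumSpanningTrees : (n : ℕ) → (Fin n → Fin n → Set) → ℕ → Set
NumSpanningTrees n A N = HasCardinality (IsSpanningTree n A) N

formula : Cotree → ℕ
formula t = product (map (λ w → δ t w ^ (numChildren t w ∸ 1)) (nonRootInteriors t))
            * nV t ^ (numChildren t [] ∸ 2)

{-# OPTIONS --safe #-}
module Submission where

-- Let M be a module of a + b vertices: all of them have the same W neighbours
-- outside M.  Let M consist of two parts of sizes a and b, completely joined or
-- not joined at all, let G' be obtained by contracting each part to one vertex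
-- (keeping parallel edges) and G'' by contracting all of M.  Then
--     (a + b) τ(G') = a b δ τ(G''),   δ = W + a + b if the parts are joined, else W.
-- Deletion–contraction of the edges that miss M reduces this to the case where
-- every remaining edge meets M, which is computed directly.
-- A node of the cotree with k children is assembled from its children by k − 1
-- such contractions, all with the same δ, the degree of that node; the factors
-- a, b and a + b telescope, leaving n τ(G) = ∏ δ(w)^(k_w − 1) over all interior
-- vertices w, where δ(root) = n.

open import Defs
open import Data.Bool as Bool using (Bool; true; false; if_then_else_; _∨_)
open import Data.Bool.Properties using (∨-zeroʳ)
open import Data.Empty using (⊥-elim)
open import Data.Fin as Fin using (Fin; zero; suc)
import Data.Fin.Properties as Fin
open import Data.List using (List; []; _∷_; _++_; map; length; filter; filterᵇ; lookup; allFin; tabulate)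
open import Data.List.Membership.Propositional using (_∈_; _∉_)
open import Data.List.Membership.Propositional.Properties using (∈-++⁺ˡ; ∈-++⁺ʳ; ∈-++⁻; ∈-map⁺; ∈-map⁻; ∈-filter⁺; ∈-filter⁻; ∈-lookup; ∈-allFin)
open import Data.List.Properties using (++-assoc; ++-identityʳ; map-++; map-∘; map-id; map-cong; map-tabulate; length-++; length-map; length-tabulate; tabulate-lookup; filter-++; filter-all; ∷-injectiveˡ; ∷-injectiveʳ; ≡-dec)
open import Data.List.Relation.Binary.Permutation.Propositional as Perm using (_↭_; ↭-refl; ↭-sym; ↭-trans; ↭-reflexive; prep; swap)
open import Data.List.Relation.Binary.Permutation.Propositional.Properties using (++⁺ˡ; ++⁺ʳ; ++-commutativeMonoid; shift; filter-↭) renaming (++⁺ to ↭-++⁺; map⁺ to ↭-map⁺)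
open import Data.List.Relation.Binary.Sublist.Propositional using (_⊆_; []; _∷_; _∷ʳ_)
open import Data.List.Relation.Binary.Sublist.Propositional.Properties using (filter-⊆; Any-resp-⊆)
open import Data.List.Relation.Unary.All as All using (All; []; _∷_; all?)
import Data.List.Relation.Unary.All.Properties as All
open import Data.List.Relation.Unary.AllPairs using (AllPairs; []; _∷_)
import Data.List.Relation.Unary.AllPairs.Properties as AllPairs
open import Data.List.Relation.Unary.Any using (here; there)
open import Data.List.Relation.Unary.Unique.Propositional using (Unique)
import Data.List.Relation.Unary.Unique.Propositional.Properties as Unique
open import Data.Maybe using (just; nothing)
open import Data.Nat as ℕ using (ℕ; zero; suc; _+_; _*_; _∸_; _^_; _≤_; _<_; _≡ᵇ_; s≤s; NonZero)
open import Data.Nat.ListAction using (sum; product)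
open import Data.Nat.ListAction.Properties using (product-++)
import Data.Nat.Properties as ℕ
open import Data.Nat.Properties using (+-identityʳ; +-assoc; +-suc; *-identityˡ; *-identityʳ; *-zeroʳ; *-suc; *-cancelˡ-≡; ≡ᵇ⇒≡; suc-injective; ≤-refl; ≤-trans; ≤-reflexive; <⇒≢; n<1+n; m≤n⇒m≤1+n; 1+n≰n)
open import Data.Nat.Tactic.RingSolver using (solve-∀)
open import Data.Product using (_×_; _,_; proj₁; proj₂; ∃; uncurry)
import Data.Product.Properties as Product
open import Data.Sum using (_⊎_; inj₁; inj₂)
open import Data.Vec as Vec using (Vec; []; _∷_)
import Data.Vec.Properties as Vec
open import Function using (_∘_; id; mk⇔; Equivalence)
open import Relation.Binary.Construct.Closure.ReflexiveTransitive using (Star; ε; _◅_; _◅◅_; reverse)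
open import Relation.Binary.Definitions using (DecidableEquality)
open import Relation.Binary.PropositionalEquality using (_≡_; _≢_; refl; sym; trans; cong; cong₂; subst; module ≡-Reasoning)
open import Relation.Nullary using (Dec; yes; no; does; ¬_)
open import Relation.Nullary.Decidable using (dec-true; dec-false; ¬?; T?)
import Algebra.Solver.CommutativeMonoid as CommutativeMonoidSolver
import Data.List.Membership.DecPropositional as DecMembership

-- Counting spanning trees by deletion and contraction

-- The identity for the two parts has an electrical reading. With weights as conductances, τ(G') /
-- τ(G'') is the effective conductance between the contracted parts. Each of the W outside
-- neighbours is tied to them with conductances a and b, hence offers a series path of conductance a
-- b / (a + b), and a link between the parts adds a b in parallel; the total is a b δ / (a + b). The
-- ratio a : b is the same at every neighbour, so the outside is at one potential, edges within it
-- carry no current, and they cannot affect the ratio. The proof stays in ℕ with denominators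
-- multiplied out, cancelling only where parts are known to be nonempty. Two obstacles shape it.
-- Contracting an edge at one part destroys the symmetry between the neighbours, so the direct
-- computation is stated for arbitrary contractions, with a corrected coefficient for neighbours
-- already absorbed (`κ`). And a part is merged while the rest of the graph is still present, so a
-- module is specified by its behaviour in all surroundings, not by its own number of spanning
-- trees.

WEdge : Set → Set
WEdge V = V × V × ℕ

AllEqual : {C : Set} → List C → Set
AllEqual cs = All (λ c → All (c ≡_) cs) cs

module WeightedCount {C : Set} (_≟_ : DecidableEquality C) where

  private variable
    V : Set

  allEqual? : (cs : List C) → Dec (AllEqual cs)
  allEqual? cs = all? (λ c → all? (c ≟_) cs) cs

  -- A map f on the vertices stands for the graph in which its fibres have been
  -- contracted, so edges never need relabelling.
  contract : (V → C) → V → V → V → C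
  contract f u v x = if does (f x ≟ f v) then f u else f x

  opaque
    -- The list `vs` is needed because the edges alone would not reveal an isolated vertex. A weight
    -- `w` stands for `w` parallel edges, of which a spanning tree uses at most one, so only the
    -- contracted term is multiplied.
    τ : List V → (V → C) → List (WEdge V) → ℕ
    τ vs f [] = if does (allEqual? (map f vs)) then 1 else 0
    τ vs f ((u , v , w) ∷ E) =
      τ vs f E + w * (if does (f u ≟ f v) then 0 else τ vs (contract f u v) E)

    τ-spanning : {vs : List V} {f : V → C} → AllEqual (map f vs) → τ vs f [] ≡ 1
    τ-spanning {vs = vs} {f} a rewrite dec-true (allEqual? (map f vs)) a = refl

    τ-nonspanning : {vs : List V} {f : V → C} → ¬ AllEqual (map f vs) → τ vs f [] ≡ 0
    τ-nonspanning {vs = vs} {f} a rewrite dec-false (allEqual? (map f vs)) a = refl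

    τ-loop : {vs : List V} {f : V → C} {u v : V} {w : ℕ} {E : List (WEdge V)} → f u ≡ f v →
      τ vs f ((u , v , w) ∷ E) ≡ τ vs f E
    τ-loop {f = f} {u} {v} {w} {E} e rewrite dec-true (f u ≟ f v) e | *-zeroʳ w = +-identityʳ _

    τ-edge : {vs : List V} {f : V → C} {u v : V} {w : ℕ} {E : List (WEdge V)} → f u ≢ f v →
      τ vs f ((u , v , w) ∷ E) ≡ τ vs f E + w * τ vs (contract f u v) E
    τ-edge {f = f} {u} {v} ne rewrite dec-false (f u ≟ f v) ne = refl

  -- Inclusion of kernels. The names of the classes carry no information, so contracted graphs are
  -- compared by `≼` in both directions instead of by equality of maps.
  _≼_ : (V → C) → (V → C) → Set
  f ≼ g = ∀ x y → f x ≡ f y → g x ≡ g y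

  ≼-refl : {f : V → C} → f ≼ f
  ≼-refl _ _ e = e

  ≼-trans : {f g h : V → C} → f ≼ g → g ≼ h → f ≼ h
  ≼-trans p q x y e = q x y (p x y e)

  contract-hit : (f : V → C) {u v x : V} → f x ≡ f v → contract f u v x ≡ f u
  contract-hit f {u} {v} {x} e rewrite dec-true (f x ≟ f v) e = refl

  contract-miss : (f : V → C) {u v x : V} → f x ≢ f v → contract f u v x ≡ f x
  contract-miss f {u} {v} {x} e rewrite dec-false (f x ≟ f v) e = refl

  contract-source : (f : V → C) (u v : V) → contract f u v u ≡ f u
  contract-source f u v with f u ≟ f v
  ... | yes _ = refl
  ... | no _ = refl

  contract-join : (f : V → C) (u v : V) → contract f u v u ≡ contract f u v v
  contract-join f u v = trans (contract-source f u v) (sym (contract-hit f refl))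

  contract-≽ : (f : V → C) (u v : V) → f ≼ contract f u v
  contract-≽ f u v x y e = cong (λ c → if does (c ≟ f v) then f u else c) e

  contract-cases : (f : V → C) (u v : V) {x y : V} → contract f u v x ≡ contract f u v y →
    f x ≡ f y ⊎ (f x ≡ f u × f y ≡ f v) ⊎ (f x ≡ f v × f y ≡ f u)
  contract-cases f u v {x} {y} e with f x ≟ f v | f y ≟ f v
  ... | yes p | yes q = inj₁ (trans p (sym q))
  ... | yes p | no _ = inj₂ (inj₂ (p , sym e))
  ... | no _ | yes q = inj₂ (inj₁ (e , q))
  ... | no _ | no _ = inj₁ e

  -- Universal property of the quotient. Two iterated contractions are shown to agree by comparing
  -- the identifications they make, without computing class names.
  contract-least : {f g : V → C} {u v : V} → f ≼ g → g u ≡ g v → contract f u v ≼ g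
  contract-least {f = f} {u = u} {v} f≼g guv x y e with contract-cases f u v e
  ... | inj₁ p = f≼g x y p
  ... | inj₂ (inj₁ (p , q)) = trans (f≼g x u p) (trans guv (sym (f≼g y v q)))
  ... | inj₂ (inj₂ (p , q)) = trans (f≼g x v p) (trans (sym guv) (sym (f≼g y u q)))

  contract-resp : {f g : V → C} {u v u' v' : V} → f ≼ g → g u ≡ g u' → g v ≡ g v' →
    contract f u v ≼ contract g u' v'
  contract-resp {g = g} {u} {v} {u'} {v'} f≼g eu ev = contract-least
    (≼-trans f≼g (contract-≽ g u' v'))
    (trans (contract-≽ g u' v' u u' eu)
      (trans (contract-join g u' v') (sym (contract-≽ g u' v' v v' ev))))

  contract-swap : {f f' : V → C} {u v p q : V} → f ≼ f' →
    contract (contract f u v) p q ≼ contract (contract f' p q) u v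
  contract-swap {f' = f} {u} {v} {p} {q} f≼f' = contract-least
    (contract-least (≼-trans f≼f' (≼-trans (contract-≽ f p q) (contract-≽ (contract f p q) u v)))
      (contract-join (contract f p q) u v))
    (contract-≽ (contract f p q) u v p q (contract-join f p q))

  allEqual-≼ : (vs : List V) {f g : V → C} → f ≼ g → AllEqual (map f vs) → AllEqual (map g vs)
  allEqual-≼ vs {f} {g} f≼g a = go vs vs a
    where
    inner : ∀ x ys → All (f x ≡_) (map f ys) → All (g x ≡_) (map g ys)
    inner x [] [] = []
    inner x (y ∷ ys) (e ∷ es) = f≼g x y e ∷ inner x ys es
    go : ∀ xs ys → All (λ c → All (c ≡_) (map f ys)) (map f xs) →
      All (λ c → All (c ≡_) (map g ys)) (map g xs)
    go [] ys [] = []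
    go (x ∷ xs) ys (p ∷ ps) = inner x ys p ∷ go xs ys ps

  allEqual-lookup : {vs : List V} {f : V → C} {x y : V} → AllEqual (map f vs) →
    x ∈ vs → y ∈ vs → f x ≡ f y
  allEqual-lookup {f = f} a x∈ y∈ = All.lookup (All.lookup a (∈-map⁺ f x∈)) (∈-map⁺ f y∈)

  τ-[]-separated : {vs : List V} {f : V → C} {x y : V} → x ∈ vs → y ∈ vs → f x ≢ f y →
    τ vs f [] ≡ 0
  τ-[]-separated x∈ y∈ fx≢fy = τ-nonspanning (λ a → fx≢fy (allEqual-lookup a x∈ y∈))

  module _ {V : Set} (vs : List V) where

    private variable
      f g : V → C
      u v : V
      w : ℕ
      E E' E'' : List (WEdge V)

    -- The recursion asks only whether two vertices share a class, and contraction preserves mutual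
    -- `≼`.
    τ-resp : f ≼ g → g ≼ f → ∀ E → τ vs f E ≡ τ vs g E
    τ-resp {f} {g} p q [] with allEqual? (map f vs)
    ... | yes a = trans (τ-spanning a) (sym (τ-spanning (allEqual-≼ vs p a)))
    ... | no ¬a = trans (τ-nonspanning ¬a) (sym (τ-nonspanning (λ a → ¬a (allEqual-≼ vs q a))))
    τ-resp {f} {g} p q ((u , v , w) ∷ E) with f u ≟ f v
    ... | yes e = trans (τ-loop e) (trans (τ-resp p q E) (sym (τ-loop (p u v e))))
    ... | no ne = trans (τ-edge ne) (trans
      (cong₂ (λ a b → a + w * b) (τ-resp p q E)
        (τ-resp (contract-resp p refl refl) (contract-resp q refl refl) E))
      (sym (τ-edge (λ e → ne (q u v e)))))

    -- Equality of counts in every further contraction of f; unlike equality of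
    -- counts at f itself, it is a congruence for adding edges.
    infix 4 _⊢_≈_
    _⊢_≈_ : (V → C) → List (WEdge V) → List (WEdge V) → Set
    f ⊢ E ≈ E' = ∀ g → f ≼ g → τ vs g E ≡ τ vs g E'

    ≈-at : f ⊢ E ≈ E' → τ vs f E ≡ τ vs f E'
    ≈-at p = p _ ≼-refl

    ≈-refl : f ⊢ E ≈ E
    ≈-refl _ _ = refl

    ≈-sym : f ⊢ E ≈ E' → f ⊢ E' ≈ E
    ≈-sym p g f≼g = sym (p g f≼g)

    ≈-trans : f ⊢ E ≈ E' → f ⊢ E' ≈ E'' → f ⊢ E ≈ E''
    ≈-trans p q g f≼g = trans (p g f≼g) (q g f≼g)

    ≈-cons : ∀ e → f ⊢ E ≈ E' → f ⊢ e ∷ E ≈ e ∷ E'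
    ≈-cons (u , v , w) p g f≼g with g u ≟ g v
    ... | yes e = trans (τ-loop e) (trans (p g f≼g) (sym (τ-loop e)))
    ... | no ne = trans (τ-edge ne) (trans
      (cong₂ (λ a b → a + w * b) (p g f≼g) (p (contract g u v) (≼-trans f≼g (contract-≽ g u v))))
      (sym (τ-edge ne)))

    ≈-++ˡ : ∀ D → f ⊢ E ≈ E' → f ⊢ D ++ E ≈ D ++ E'
    ≈-++ˡ [] p = p
    ≈-++ˡ (e ∷ D) p = ≈-cons e (≈-++ˡ D p)

    ≈-swap : ∀ d e → f ⊢ d ∷ e ∷ E ≈ e ∷ d ∷ E
    ≈-swap {E = E} (u , v , w) (p , q , z) g _ = by-cases (g u ≟ g v) (g p ≟ g q)
      where
      open ≡-Reasoning
      A = τ vs g E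
      X = τ vs (contract g p q) E
      Y = τ vs (contract g u v) E
      Z = τ vs (contract (contract g u v) p q) E
      Z' = τ vs (contract (contract g p q) u v) E
      exchange : ∀ a b c → (a + b) + c ≡ (a + c) + b
      exchange = solve-∀
      exchange₂ : ∀ a w x y z t → (a + z * x) + w * (y + z * t) ≡ (a + w * y) + z * (x + w * t)
      exchange₂ = solve-∀
      -- A non-loop that becomes a loop when another edge is contracted is parallel to that edge,
      -- and being parallel is symmetric.
      merged-loop : ∀ {u v p q} → g u ≢ g v → contract g p q u ≡ contract g p q v →
        contract g u v p ≡ contract g u v q
      merged-loop {u} {v} {p} {q} a h with contract-cases g p q h
      ... | inj₁ e = ⊥-elim (a e)
      ... | inj₂ (inj₁ (e , e')) = trans (contract-≽ g u v p u (sym e))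
             (trans (contract-join g u v) (contract-≽ g u v v q e'))
      ... | inj₂ (inj₂ (e , e')) = trans (contract-≽ g u v p v (sym e'))
             (trans (sym (contract-join g u v)) (contract-≽ g u v u q e))
      Goal = τ vs g ((u , v , w) ∷ (p , q , z) ∷ E) ≡ τ vs g ((p , q , z) ∷ (u , v , w) ∷ E)
      both-edges : g u ≢ g v → g p ≢ g q → Dec (contract g u v p ≡ contract g u v q) → Goal
      both-edges a b (yes c) = begin
        τ vs g ((u , v , w) ∷ (p , q , z) ∷ E) ≡⟨ τ-edge a ⟩
        τ vs g ((p , q , z) ∷ E) + w * τ vs (contract g u v) ((p , q , z) ∷ E)
           ≡⟨ cong₂ (λ s t → s + w * t) (τ-edge b) (τ-loop c) ⟩
        (A + z * X) + w * Y      ≡⟨ exchange A (z * X) (w * Y) ⟩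
        (A + w * Y) + z * X
           ≡⟨ cong₂ (λ s t → s + z * t) (τ-edge a) (τ-loop (merged-loop b c)) ⟨
        τ vs g ((u , v , w) ∷ E) + z * τ vs (contract g p q) ((u , v , w) ∷ E) ≡⟨ τ-edge b ⟨
        τ vs g ((p , q , z) ∷ (u , v , w) ∷ E) ∎
      both-edges a b (no c) = begin
        τ vs g ((u , v , w) ∷ (p , q , z) ∷ E) ≡⟨ τ-edge a ⟩
        τ vs g ((p , q , z) ∷ E) + w * τ vs (contract g u v) ((p , q , z) ∷ E)
           ≡⟨ cong₂ (λ s t → s + w * t) (τ-edge b) (τ-edge c) ⟩
        (A + z * X) + w * (Y + z * Z)      ≡⟨ exchange₂ A w X Y z Z ⟩
        (A + w * Y) + z * (X + w * Z)
           ≡⟨ cong (λ t → (A + w * Y) + z * (X + w * t))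
                (τ-resp (contract-swap ≼-refl) (contract-swap ≼-refl) E) ⟩
        (A + w * Y) + z * (X + w * Z')
           ≡⟨ cong₂ (λ s t → s + z * t) (τ-edge a) (τ-edge (λ h → c (merged-loop a h))) ⟨
        τ vs g ((u , v , w) ∷ E) + z * τ vs (contract g p q) ((u , v , w) ∷ E) ≡⟨ τ-edge b ⟨
        τ vs g ((p , q , z) ∷ (u , v , w) ∷ E) ∎
      by-cases : Dec (g u ≡ g v) → Dec (g p ≡ g q) → Goal
      by-cases (yes a) (yes b) = trans (trans (τ-loop a) (τ-loop b))
        (sym (trans (τ-loop b) (τ-loop a)))
      by-cases (yes a) (no b) = begin
        τ vs g ((u , v , w) ∷ (p , q , z) ∷ E) ≡⟨ τ-loop a ⟩
        τ vs g ((p , q , z) ∷ E)               ≡⟨ τ-edge b ⟩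
        A + z * X                              ≡⟨ cong₂ (λ s t → s + z * t) (τ-loop a)
                                                    (τ-loop (contract-≽ g p q u v a)) ⟨
        τ vs g ((u , v , w) ∷ E) + z * τ vs (contract g p q) ((u , v , w) ∷ E) ≡⟨ τ-edge b ⟨
        τ vs g ((p , q , z) ∷ (u , v , w) ∷ E) ∎
      by-cases (no a) (yes b) = begin
        τ vs g ((u , v , w) ∷ (p , q , z) ∷ E) ≡⟨ τ-edge a ⟩
        τ vs g ((p , q , z) ∷ E) + w * τ vs (contract g u v) ((p , q , z) ∷ E)
           ≡⟨ cong₂ (λ s t → s + w * t) (τ-loop b) (τ-loop (contract-≽ g u v p q b)) ⟩
        A + w * Y                              ≡⟨ τ-edge a ⟨
        τ vs g ((u , v , w) ∷ E)               ≡⟨ τ-loop b ⟨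
        τ vs g ((p , q , z) ∷ (u , v , w) ∷ E) ∎
      by-cases (no a) (no b) = both-edges a b (contract g u v p ≟ contract g u v q)

    ≈-perm : E ↭ E' → f ⊢ E ≈ E'
    ≈-perm Perm.refl = ≈-refl
    ≈-perm (prep e p) = ≈-cons e (≈-perm p)
    ≈-perm (swap d e p) = ≈-trans (≈-swap d e) (≈-cons e (≈-cons d (≈-perm p)))
    ≈-perm (Perm.trans p q) = ≈-trans (≈-perm p) (≈-perm q)

    ≈-relabel : ∀ {u' v'} → f u ≡ f u' → f v ≡ f v' → f ⊢ (u , v , w) ∷ E ≈ (u' , v' , w) ∷ E
    ≈-relabel {u = u} {v} {w} {E} {u'} {v'} eu ev g f≼g with g u ≟ g v
    ... | yes e = trans (τ-loop e)
           (sym (τ-loop (trans (sym (f≼g u u' eu)) (trans e (f≼g v v' ev)))))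
    ... | no ne = trans (τ-edge ne) (trans
      (cong (λ t → τ vs g E + w * t)
        (τ-resp (contract-resp ≼-refl (f≼g u u' eu) (f≼g v v' ev))
                (contract-resp ≼-refl (sym (f≼g u u' eu)) (sym (f≼g v v' ev))) E))
      (sym (τ-edge (λ e → ne (trans (f≼g u u' eu) (trans e (sym (f≼g v v' ev))))))))

    ≈-flip : f ⊢ (u , v , w) ∷ E ≈ (v , u , w) ∷ E
    ≈-flip {u = u} {v} {w} {E} g _ with g u ≟ g v
    ... | yes e = trans (τ-loop e) (sym (τ-loop (sym e)))
    ... | no ne = trans (τ-edge ne) (trans
      (cong (λ t → τ vs g E + w * t)
        (τ-resp (contract-least (contract-≽ g v u) (sym (contract-join g v u)))
                (contract-least (contract-≽ g u v) (sym (contract-join g u v))) E))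
      (sym (τ-edge (λ e → ne (sym e)))))

    ≈-loop : f u ≡ f v → f ⊢ (u , v , w) ∷ E ≈ E
    ≈-loop {u = u} {v} e g f≼g = τ-loop (f≼g u v e)

    ≈-null : f ⊢ (u , v , 0) ∷ E ≈ E
    ≈-null {u = u} {v} g _ with g u ≟ g v
    ... | yes e = τ-loop e
    ... | no ne = trans (τ-edge ne) (+-identityʳ _)

    ≈-parallel : ∀ {w'} → f ⊢ (u , v , w) ∷ (u , v , w') ∷ E ≈ (u , v , w + w') ∷ E
    ≈-parallel {u = u} {v} {w} {E} {w'} g _ with g u ≟ g v
    ... | yes e = trans (τ-loop e) (trans (τ-loop e) (sym (τ-loop e)))
    ... | no ne = begin
      τ vs g ((u , v , w) ∷ (u , v , w') ∷ E) ≡⟨ τ-edge ne ⟩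
      τ vs g ((u , v , w') ∷ E) + w * τ vs (contract g u v) ((u , v , w') ∷ E)
        ≡⟨ cong₂ (λ s t → s + w * t) (τ-edge ne) (τ-loop (contract-join g u v)) ⟩
      A + w' * B + w * B       ≡⟨ arith A B w w' ⟩
      A + (w + w') * B         ≡⟨ τ-edge ne ⟨
      τ vs g ((u , v , w + w') ∷ E) ∎
      where
      open ≡-Reasoning
      A = τ vs g E
      B = τ vs (contract g u v) E
      arith : ∀ a b w w' → a + w' * b + w * b ≡ a + (w + w') * b
      arith = solve-∀

-- Merging twin vertices

hub : {V : Set} → V → ℕ → List V → List (WEdge V)
hub u s [] = []
hub u s (i ∷ I) = (u , i , s) ∷ hub u s I

-- Two hubs over the same `I`, interleaved so that an induction on `I` removes both edges at `i`
-- together.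
star : {V : Set} → V → V → ℕ → ℕ → List V → List (WEdge V)
star u v a b [] = []
star u v a b (i ∷ I) = (u , i , a) ∷ (v , i , b) ∷ star u v a b I

module Twins {C : Set} (_≟_ : DecidableEquality C) {V : Set} (vs : List V) where
  open WeightedCount _≟_

  private variable
    f g : V → C

  multiplicity : (V → C) → V → List V → ℕ
  multiplicity f i [] = 0
  multiplicity f i (j ∷ I) = (if does (f j ≟ f i) then 1 else 0) + multiplicity f i I

  multiplicity-contract : ∀ u j i I → f i ≢ f u → f i ≢ f j →
    multiplicity (contract f u j) i I ≡ multiplicity f i I
  multiplicity-contract u j i [] iu ij = refl
  multiplicity-contract {f} u j i (k ∷ I) iu ij =
    cong₂ _+_ head (multiplicity-contract u j i I iu ij)
    where
    head : (if does (contract f u j k ≟ contract f u j i) then 1 else 0) ≡ (if does (f k ≟ f i) then 1 else 0)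
    head rewrite contract-miss f {u} {j} ij with f k ≟ f j
    ... | yes kj rewrite dec-false (f u ≟ f i) (λ e → iu (sym e))
                       | dec-false (f k ≟ f i) (λ e → ij (trans (sym e) kj)) = refl
    ... | no _ = refl

  star-hub : ∀ {u v} a b I → f u ≡ f v → _⊢_≈_ vs f (star u v a b I) (hub u (a + b) I)
  star-hub a b [] e = ≈-refl vs
  star-hub {f} {u} {v} a b (i ∷ I) e =
    ≈-trans vs (≈-cons vs (u , i , a) (≈-relabel vs (sym e) refl))
      (≈-trans vs (≈-parallel vs) (≈-cons vs (u , i , a + b) (star-hub a b I e)))

  -- When all edges meet the hub, the class of i is attached to it by exactly
  -- one of the edges ending in that class.
  hub-expand : ∀ {u i} s I → u ∈ vs → i ∈ vs → g i ≢ g u →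
    τ vs g (hub u s I) ≡ s * multiplicity g i I * τ vs (contract g u i) (hub u s I)
  hub-expand s [] u∈ i∈ ne rewrite *-zeroʳ s = τ-[]-separated i∈ u∈ ne
  hub-expand {g} {u} {i} s (j ∷ I) u∈ i∈ ne with g j ≟ g u | g j ≟ g i
  ... | yes ju | yes ji = ⊥-elim (ne (trans (sym ji) ju))
  ... | yes ju | no _ = trans (τ-loop (sym ju)) (trans (hub-expand s I u∈ i∈ ne)
        (cong (s * multiplicity g i I *_) (sym (τ-loop (contract-≽ g u i u j (sym ju))))))
  ... | no ju | yes ji = begin
      τ vs g ((u , j , s) ∷ hub u s I)                     ≡⟨ τ-edge (λ e → ju (sym e)) ⟩
      τ vs g (hub u s I) + s * τ vs (contract g u j) (hub u s I)
         ≡⟨ cong₂ (λ x y → x + s * y) (hub-expand s I u∈ i∈ ne)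
              (τ-resp vs (contract-resp ≼-refl refl ji) (contract-resp ≼-refl refl (sym ji)) (hub u s I)) ⟩
      s * m * X + s * X                                    ≡⟨ arith s m X ⟩
      s * (1 + m) * X                                      ≡⟨ cong (s * (1 + m) *_)
         (τ-loop (trans (contract-join g u i) (contract-≽ g u i i j (sym ji)))) ⟨
      s * (1 + m) * τ vs (contract g u i) ((u , j , s) ∷ hub u s I) ∎
      where
      open ≡-Reasoning
      m = multiplicity g i I
      X = τ vs (contract g u i) (hub u s I)
      arith : ∀ s m x → s * m * x + s * x ≡ s * (1 + m) * x
      arith = solve-∀
  ... | no ju | no ji = begin
      τ vs g ((u , j , s) ∷ hub u s I)                     ≡⟨ τ-edge (λ e → ju (sym e)) ⟩
      τ vs g (hub u s I) + s * τ vs (contract g u j) (hub u s I)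
         ≡⟨ cong₂ (λ x y → x + s * y) (hub-expand s I u∈ i∈ ne)
              (hub-expand s I u∈ i∈ ne') ⟩
      s * m * X + s * (s * multiplicity (contract g u j) i I * τ vs (contract (contract g u j) u i) (hub u s I))
         ≡⟨ cong₂ (λ x y → s * m * X + s * (s * x * y))
              (multiplicity-contract u j i I ne (λ e → ji (sym e)))
              (τ-resp vs (contract-swap ≼-refl) (contract-swap ≼-refl) (hub u s I)) ⟩
      s * m * X + s * (s * m * Y)                          ≡⟨ arith s m X Y ⟩
      s * m * (X + s * Y)                                  ≡⟨ cong (s * m *_) (τ-edge uj) ⟨
      s * m * τ vs (contract g u i) ((u , j , s) ∷ hub u s I) ∎
      where
      open ≡-Reasoning
      m = multiplicity g i I
      X = τ vs (contract g u i) (hub u s I)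
      Y = τ vs (contract (contract g u i) u j) (hub u s I)
      ne' : contract g u j i ≢ contract g u j u
      ne' e = ne (trans (sym (contract-miss g (λ e' → ji (sym e')))) (trans e (contract-source g u j)))
      uj : contract g u i u ≢ contract g u i j
      uj e = ju (sym (trans (sym (contract-source g u i)) (trans e (contract-miss g ji))))
      arith : ∀ s m x y → s * m * x + s * (s * m * y) ≡ s * m * (x + s * y)
      arith = solve-∀

  module _ (u v : V) (a b : ℕ) where

    -- This is `a + b` times the conductance between `u` and `v` through `i`: the series connection
    -- `a b / (a + b)` while `i` is free, and a direct edge of weight `b` or `a` once `i` has been
    -- absorbed by `u` or by `v`.
    κ : (V → C) → V → ℕ
    κ f i = if does (f i ≟ f u) then (a + b) * b else if does (f i ≟ f v) then (a + b) * a else a * b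

    κs : (V → C) → List V → ℕ
    κs f [] = 0
    κs f (i ∷ I) = κ f i + κs f I

    κ-u : ∀ {i} → f i ≡ f u → κ f i ≡ (a + b) * b
    κ-u {f} {i} e rewrite dec-true (f i ≟ f u) e = refl

    κ-v : ∀ {i} → f i ≢ f u → f i ≡ f v → κ f i ≡ (a + b) * a
    κ-v {f} {i} ne e rewrite dec-false (f i ≟ f u) ne | dec-true (f i ≟ f v) e = refl

    κ-free : ∀ {i} → f i ≢ f u → f i ≢ f v → κ f i ≡ a * b
    κ-free {f} {i} ne ne' rewrite dec-false (f i ≟ f u) ne | dec-false (f i ≟ f v) ne' = refl

    κs-free : ∀ I → All (λ i → f i ≢ f u × f i ≢ f v) I → κs f I ≡ a * b * length I
    κs-free [] [] = sym (*-zeroʳ (a * b))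
    κs-free {f} (i ∷ I) ((iu , iv) ∷ ps) =
      trans (cong₂ _+_ (κ-free {f} iu iv) (κs-free {f} I ps)) (arith (a * b) (length I))
      where
      arith : ∀ c n → c + c * n ≡ c * (1 + n)
      arith = solve-∀

    -- Only entries in the class of `i` change. Such an entry contributes
    -- `a (a + b) b + b (a + b) a` on the left, which exceeds `(a + b) (a b)` by one more
    -- `(a + b) (a b)`: its share of the multiplicity.
    κs-contract : ∀ {i} → f u ≢ f v → f i ≢ f u → f i ≢ f v → ∀ I →
      a * κs (contract f u i) I + b * κs (contract f v i) I
        ≡ (a + b) * κs f I + (a + b) * (a * b) * multiplicity f i I
    κs-contract {f} {i} uv iu iv [] rewrite *-zeroʳ a | *-zeroʳ b | *-zeroʳ (a + b) | *-zeroʳ ((a + b) * (a * b)) = refl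
    κs-contract {f} {i} uv iu iv (j ∷ I) = begin
        a * (κ fu j + κs fu I) + b * (κ fv j + κs fv I)
          ≡⟨ split a b (κ fu j) (κs fu I) (κ fv j) (κs fv I) ⟩
        (a * κ fu j + b * κ fv j) + (a * κs fu I + b * κs fv I)
          ≡⟨ cong₂ _+_ (head (f j ≟ f i)) (κs-contract {f} uv iu iv I) ⟩
        ((a + b) * κ f j + (a + b) * (a * b) * δj) + ((a + b) * κs f I + (a + b) * (a * b) * multiplicity f i I)
          ≡⟨ gather (a + b) (a * b) (κ f j) δj (κs f I) (multiplicity f i I) ⟩
        (a + b) * (κ f j + κs f I) + (a + b) * (a * b) * (δj + multiplicity f i I) ∎
      where
      open ≡-Reasoning
      fu fv : V → C
      fu = contract f u i
      fv = contract f v i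
      δj = if does (f j ≟ f i) then 1 else 0
      split : ∀ a b x y z t → a * (x + y) + b * (z + t) ≡ (a * x + b * z) + (a * y + b * t)
      split = solve-∀
      gather : ∀ s p x d y m → (s * x + s * p * d) + (s * y + s * p * m) ≡ s * (x + y) + s * p * (d + m)
      gather = solve-∀
      ui : f u ≢ f i
      ui e = iu (sym e)
      vi : f v ≢ f i
      vi e = iv (sym e)
      fuu : fu u ≡ f u
      fuu = contract-miss f ui
      fuv : fu v ≡ f v
      fuv = contract-miss f vi
      fvu : fv u ≡ f u
      fvu = contract-miss f ui
      fvv : fv v ≡ f v
      fvv = contract-miss f vi
      linear : ∀ a b x → a * x + b * x ≡ (a + b) * x + (a + b) * (a * b) * 0
      linear = solve-∀
      quadratic : ∀ a b → a * ((a + b) * b) + b * ((a + b) * a) ≡ (a + b) * (a * b) + (a + b) * (a * b) * 1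
      quadratic = solve-∀
      head : (d : Dec (f j ≡ f i)) →
        a * κ fu j + b * κ fv j ≡ (a + b) * κ f j + (a + b) * (a * b) * (if does d then 1 else 0)
      head (yes ji) = trans
          (cong₂ (λ x y → a * x + b * y)
            (κ-u {fu} {j} (trans (contract-hit f ji) (sym fuu)))
            (κ-v {fv} {j} (λ e → uv (sym (trans (sym (contract-hit f ji)) (trans e fvu))))
                      (trans (contract-hit f ji) (sym fvv))))
          (trans (quadratic a b)
            (cong (λ x → (a + b) * x + (a + b) * (a * b) * 1)
              (sym (κ-free {f} {j} (λ e → iu (trans (sym ji) e)) (λ e → iv (trans (sym ji) e))))))
      head (no ji) = trans (cong₂ (λ x y → a * x + b * y) same-u same-v) (linear a b (κ f j))
        where
        same-u : κ fu j ≡ κ f j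
        same-u rewrite fuu | fuv | contract-miss f {u} {i} ji = refl
        same-v : κ fv j ≡ κ f j
        same-v rewrite fvu | fvv | contract-miss f {v} {i} ji = refl

    -- Induction on `I`. Contracting an edge at its head may put later entries into the class of `u`
    -- or `v`; hence `f` is arbitrary and the coefficient is `κs f I` instead of a multiple of
    -- `length I`.
    star-twins : u ∈ vs → v ∈ vs → f u ≢ f v → ∀ I → All (_∈ vs) I →
      (a + b) * τ vs f (star u v a b I) ≡ κs f I * τ vs (contract f u v) (star u v a b I)
    star-twins u∈ v∈ uv [] [] = trans (cong ((a + b) *_) (τ-[]-separated u∈ v∈ uv)) (*-zeroʳ (a + b))
    star-twins {f} u∈ v∈ uv (i ∷ I) (i∈ ∷ I∈) = by-cases (f i ≟ f u) (f i ≟ f v)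
      where
      open ≡-Reasoning
      uv' = contract f u v
      S = star u v a b I
      A = τ vs f S
      B = τ vs uv' S
      IH = star-twins {f} u∈ v∈ uv I I∈
      Goal = (a + b) * τ vs f (star u v a b (i ∷ I)) ≡ κs f (i ∷ I) * τ vs uv' (star u v a b (i ∷ I))

      collapse : uv' u ≡ uv' i → τ vs uv' (star u v a b (i ∷ I)) ≡ B
      collapse e = trans (τ-loop e) (τ-loop (trans (sym (contract-join f u v)) e))

      absorbed : ∀ s x k A B → s * A ≡ k * B → s * (A + x * B) ≡ (s * x + k) * B
      absorbed s x k A B e = trans (dist s A x B) (trans (cong (_+ s * (x * B)) e) (dist' s x k B))
        where
        dist : ∀ s A x B → s * (A + x * B) ≡ s * A + s * (x * B)
        dist = solve-∀
        dist' : ∀ s x k B → k * B + s * (x * B) ≡ (s * x + k) * B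
        dist' = solve-∀

      -- The edge from `u` to `i` is a loop, and contracting the edge from `v` to `i` amounts to
      -- contracting `u` with `v`.
      at-u : f i ≡ f u → Goal
      at-u e = begin
        (a + b) * τ vs f (star u v a b (i ∷ I))
          ≡⟨ cong ((a + b) *_) (trans (τ-loop (sym e)) (τ-edge (λ vi → uv (trans (sym e) (sym vi))))) ⟩
        (a + b) * (A + b * τ vs (contract f v i) S)
          ≡⟨ cong (λ x → (a + b) * (A + b * x)) (τ-resp vs
               (contract-least (contract-≽ f u v) (trans (sym (contract-join f u v)) (contract-≽ f u v u i (sym e))))
               (contract-least (contract-≽ f v i) (trans (contract-≽ f v i u i (sym e)) (sym (contract-join f v i)))) S) ⟩
        (a + b) * (A + b * B)          ≡⟨ absorbed (a + b) b (κs f I) A B IH ⟩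
        ((a + b) * b + κs f I) * B     ≡⟨ cong₂ (λ x y → (x + κs f I) * y) (κ-u {f} e)
                                            (collapse (contract-≽ f u v u i (sym e))) ⟨
        κs f (i ∷ I) * τ vs uv' (star u v a b (i ∷ I)) ∎

      at-v : f i ≢ f u → f i ≡ f v → Goal
      at-v ne e = begin
        (a + b) * τ vs f (star u v a b (i ∷ I))
          ≡⟨ cong ((a + b) *_) (trans (τ-edge (λ ui → ne (sym ui)))
               (cong₂ (λ x y → x + a * y) (τ-loop (sym e)) (τ-loop (contract-≽ f u i v i (sym e))))) ⟩
        (a + b) * (A + a * τ vs (contract f u i) S)
          ≡⟨ cong (λ x → (a + b) * (A + a * x)) (τ-resp vs
               (contract-resp ≼-refl refl e) (contract-resp ≼-refl refl (sym e)) S) ⟩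
        (a + b) * (A + a * B)          ≡⟨ absorbed (a + b) a (κs f I) A B IH ⟩
        ((a + b) * a + κs f I) * B     ≡⟨ cong₂ (λ x y → (x + κs f I) * y) (κ-v {f} ne e)
                                            (collapse (trans (contract-join f u v) (contract-≽ f u v v i (sym e)))) ⟨
        κs f (i ∷ I) * τ vs uv' (star u v a b (i ∷ I)) ∎

      free : f i ≢ f u → f i ≢ f v → Goal
      free iu iv = begin
        (a + b) * τ vs f ((u , i , a) ∷ (v , i , b) ∷ S)
          ≡⟨ cong ((a + b) *_) (trans (τ-edge ui) (cong₂ (λ x y → x + a * y) (τ-edge vi) (τ-edge vi'))) ⟩
        (a + b) * ((A + b * V') + a * (U' + b * τ vs (contract fu v i) S))
          ≡⟨ cong (λ x → (a + b) * ((A + b * V') + a * (U' + b * x))) (τ-resp vs fu-vi≼h h≼fu-vi S) ⟩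
        (a + b) * ((A + b * V') + a * (U' + b * H))
          ≡⟨ dist a b A U' V' H ⟩
        (a + b) * A + a * ((a + b) * U') + b * ((a + b) * V') + (a + b) * (a * b) * H
          ≡⟨ cong (_+ (a + b) * (a * b) * H) (cong₂ _+_ (cong₂ _+_ IH (cong (a *_) IH-u)) (cong (b *_) IH-v)) ⟩
        κs f I * B + a * (κs fu I * H) + b * (κs fv I * H) + (a + b) * (a * b) * H
          ≡⟨ collect a b (κs f I) B (κs fu I) (κs fv I) H ⟩
        κs f I * B + (a * κs fu I + b * κs fv I) * H + (a + b) * (a * b) * H
          ≡⟨ cong (λ x → κs f I * B + x * H + (a + b) * (a * b) * H) (κs-contract {f} uv iu iv I) ⟩
        κs f I * B + ((a + b) * κs f I + (a + b) * (a * b) * m) * H + (a + b) * (a * b) * H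
          ≡⟨ factor (a + b) (a * b) (κs f I) B m H ⟩
        κs f I * B + (a + b) * (κs f I + a * b) * H + (a * b) * ((a + b) * m * H)
          -- With `u` and `v` merged the star is a hub of weight `a + b`, whose expansion at `i` is
          -- `B = (a + b) m H`. The surplus from `κs-contract` is thus `a b B`, the contribution of
          -- `i` that was still missing.
          ≡⟨ cong (λ x → κs f I * B + (a + b) * (κs f I + a * b) * H + (a * b) * x) B-expand ⟨
        κs f I * B + (a + b) * (κs f I + a * b) * H + (a * b) * B
          ≡⟨ regroup (a + b) (a * b) (κs f I) B H ⟩
        (a * b + κs f I) * (B + (a + b) * H)
          ≡⟨ cong₂ (λ x y → (x + κs f I) * y) (κ-free {f} iu iv) step ⟨
        κs f (i ∷ I) * τ vs uv' ((u , i , a) ∷ (v , i , b) ∷ S) ∎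
        where
        fu fv h : V → C
        fu = contract f u i
        fv = contract f v i
        h = contract uv' u i
        U' = τ vs fu S
        V' = τ vs fv S
        H = τ vs h S
        m = multiplicity f i I
        ui : f u ≢ f i
        ui e = iu (sym e)
        vi : f v ≢ f i
        vi e = iv (sym e)
        vi' : fu v ≢ fu i
        vi' e = uv (sym (trans (sym (contract-miss f vi)) (trans e (contract-hit f refl))))
        uv-u : uv' u ≡ f u
        uv-u = contract-source f u v
        uv-i : uv' i ≡ f i
        uv-i = contract-miss f iv
        iu' : uv' i ≢ uv' u
        iu' e = iu (trans (sym uv-i) (trans e uv-u))
        uv≼h : uv' ≼ h
        uv≼h = contract-≽ uv' u i
        f≼h : f ≼ h
        f≼h = ≼-trans (contract-≽ f u v) uv≼h
        h-ui : h u ≡ h i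
        h-ui = contract-join uv' u i
        h-uv : h u ≡ h v
        h-uv = uv≼h u v (contract-join f u v)
        h-vi : h v ≡ h i
        h-vi = trans (sym h-uv) h-ui
        h-least : {k : V → C} → f ≼ k → k u ≡ k v → k u ≡ k i → h ≼ k
        h-least f≼k kuv kui = contract-least (contract-least f≼k kuv) kui
        fu-vi≼h : contract fu v i ≼ h
        fu-vi≼h = contract-least (contract-least f≼h h-ui) h-vi
        h≼fu-vi : h ≼ contract fu v i
        h≼fu-vi = h-least (≼-trans (contract-≽ f u i) up) (trans fuvi-ui (sym (contract-join fu v i))) fuvi-ui
          where
          up : fu ≼ contract fu v i
          up = contract-≽ fu v i
          fuvi-ui = up u i (contract-join f u i)
        IH-u : (a + b) * U' ≡ κs fu I * H
        IH-u = trans (star-twins {fu} u∈ v∈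
                 (λ e → uv (trans (sym (contract-miss f ui)) (trans e (contract-miss f vi)))) I I∈)
               (cong (κs fu I *_) (τ-resp vs
                 (contract-least (contract-least f≼h h-ui) h-uv)
                 (h-least (≼-trans (contract-≽ f u i) (contract-≽ fu u v)) (contract-join fu u v)
                   (contract-≽ fu u v u i (contract-join f u i))) S))
        IH-v : (a + b) * V' ≡ κs fv I * H
        IH-v = trans (star-twins {fv} u∈ v∈
                 (λ e → uv (trans (sym (contract-miss f ui)) (trans e (contract-miss f vi)))) I I∈)
               (cong (κs fv I *_) (τ-resp vs
                 (contract-least (contract-least f≼h h-vi) h-uv)
                 (h-least (≼-trans (contract-≽ f v i) (contract-≽ fv u v)) (contract-join fv u v)
                   (trans (contract-join fv u v) (contract-≽ fv u v v i (contract-join f v i)))) S))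
        as-hub : ∀ k → uv' ≼ k → τ vs k S ≡ τ vs k (hub u (a + b) I)
        as-hub k uv≼k = star-hub {uv'} a b I (contract-join f u v) k uv≼k
        B-expand : B ≡ (a + b) * m * H
        B-expand = trans (as-hub uv' ≼-refl) (trans (hub-expand (a + b) I u∈ i∈ iu')
          (cong₂ (λ x y → (a + b) * x * y) (multiplicity-contract u v i I iu iv) (sym (as-hub h uv≼h))))
        step : τ vs uv' ((u , i , a) ∷ (v , i , b) ∷ S) ≡ B + (a + b) * H
        step = trans (≈-at vs (≈-trans vs (≈-cons vs (u , i , a) (≈-relabel vs (sym (contract-join f u v)) refl))
                 (≈-parallel vs)))
               (τ-edge (λ e → iu' (sym e)))
        dist : ∀ a b A U V H → (a + b) * ((A + b * V) + a * (U + b * H))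
          ≡ (a + b) * A + a * ((a + b) * U) + b * ((a + b) * V) + (a + b) * (a * b) * H
        dist = solve-∀
        collect : ∀ a b k B x y H → k * B + a * (x * H) + b * (y * H) + (a + b) * (a * b) * H
          ≡ k * B + (a * x + b * y) * H + (a + b) * (a * b) * H
        collect = solve-∀
        factor : ∀ s p k B m H → k * B + (s * k + s * p * m) * H + s * p * H
          ≡ k * B + s * (k + p) * H + p * (s * m * H)
        factor = solve-∀
        regroup : ∀ s p k B H → k * B + s * (k + p) * H + p * B ≡ (p + k) * (B + s * H)
        regroup = solve-∀

      by-cases : Dec (f i ≡ f u) → Dec (f i ≡ f v) → Goal
      by-cases (yes e) _ = at-u e
      by-cases (no ne) (yes e) = at-v ne e
      by-cases (no ne) (no ne') = free ne ne'

    Apart : (V → C) → V → Set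
    Apart f x = f x ≢ f u × f x ≢ f v

    -- Deletion–contraction along the edges missing u and v treats both sides
    -- alike, so only the edges at u and v matter.
    twins : u ∈ vs → v ∈ vs → f u ≢ f v → ∀ R I → All (_∈ vs) I →
      All (λ (p , q , _) → Apart f p × Apart f q) R → All (Apart f) I →
      (a + b) * τ vs f (R ++ star u v a b I) ≡ a * b * length I * τ vs (contract f u v) (R ++ star u v a b I)
    twins {f} u∈ v∈ uv [] I I∈ [] apart =
      trans (star-twins {f} u∈ v∈ uv I I∈) (cong (_* τ vs (contract f u v) (star u v a b I)) (κs-free {f} I apart))
    twins {f} u∈ v∈ uv ((p , q , w) ∷ R) I I∈ (((pu , pv) , (qu , qv)) ∷ aR) aI with f p ≟ f q
    ... | yes pq = begin
        (a + b) * τ vs f ((p , q , w) ∷ X)     ≡⟨ cong ((a + b) *_) (τ-loop pq) ⟩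
        (a + b) * τ vs f X                     ≡⟨ twins {f} u∈ v∈ uv R I I∈ aR aI ⟩
        k * τ vs (contract f u v) X            ≡⟨ cong (k *_) (τ-loop (contract-≽ f u v p q pq)) ⟨
        k * τ vs (contract f u v) ((p , q , w) ∷ X) ∎
      where
      open ≡-Reasoning
      X = R ++ star u v a b I
      k = a * b * length I
    ... | no pq = begin
        (a + b) * τ vs f ((p , q , w) ∷ X)     ≡⟨ cong ((a + b) *_) (τ-edge pq) ⟩
        (a + b) * (τ vs f X + w * τ vs f' X)   ≡⟨ dist (a + b) w (τ vs f X) (τ vs f' X) ⟩
        (a + b) * τ vs f X + w * ((a + b) * τ vs f' X)
          ≡⟨ cong₂ (λ x y → x + w * y) (twins {f} u∈ v∈ uv R I I∈ aR aI)
               (twins {f'} u∈ v∈ (λ e → uv (trans (sym f'u) (trans e f'v))) R I I∈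
                 (All.map (λ (s , t) → apart s , apart t) aR) (All.map apart aI)) ⟩
        k * τ vs (contract f u v) X + w * (k * τ vs (contract f' u v) X)
          ≡⟨ cong (λ x → k * τ vs (contract f u v) X + w * (k * x))
               (τ-resp vs (contract-swap ≼-refl) (contract-swap ≼-refl) X) ⟩
        k * τ vs (contract f u v) X + w * (k * τ vs (contract (contract f u v) p q) X)
          ≡⟨ dist k w (τ vs (contract f u v) X) (τ vs (contract (contract f u v) p q) X) ⟨
        k * (τ vs (contract f u v) X + w * τ vs (contract (contract f u v) p q) X)
          ≡⟨ cong (k *_) (τ-edge (λ e → pq (trans (sym (contract-miss f pv)) (trans e (contract-miss f qv))))) ⟨
        k * τ vs (contract f u v) ((p , q , w) ∷ X) ∎
      where
      open ≡-Reasoning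
      X = R ++ star u v a b I
      k = a * b * length I
      f' : V → C
      f' = contract f p q
      f'u : f' u ≡ f u
      f'u = contract-miss f (λ e → qu (sym e))
      f'v : f' v ≡ f v
      f'v = contract-miss f (λ e → qv (sym e))
      dist : ∀ s w x y → s * (x + w * y) ≡ s * x + w * (s * y)
      dist = solve-∀
      apart₁ : ∀ {x z} → f' z ≡ f z → f p ≢ f z → f x ≢ f z → f' x ≢ f' z
      apart₁ {x} f'z pz xz e with f x ≟ f q
      ... | yes _ = pz (trans e f'z)
      ... | no _ = xz (trans e f'z)
      apart : ∀ {x} → Apart f x → Apart f' x
      apart (xu , xv) = apart₁ f'u pu xu , apart₁ f'v pv xv

-- Modules

module _ {V : Set} where

  private module ++-Solver = CommutativeMonoidSolver (++-commutativeMonoid {A = WEdge V})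

  spokes : List V → V → List (WEdge V)
  spokes M i = map (λ x → (x , i , 1)) M

  cross : List V → List V → List (WEdge V)
  cross M [] = []
  cross M (i ∷ N) = spokes M i ++ cross M N

  cross-++ʳ : ∀ M N N' → cross M (N ++ N') ≡ cross M N ++ cross M N'
  cross-++ʳ M [] N' = refl
  cross-++ʳ M (i ∷ N) N' =
    trans (cong (spokes M i ++_) (cross-++ʳ M N N')) (sym (++-assoc (spokes M i) (cross M N) (cross M N')))

  cross-++ˡ : ∀ M M' N → cross (M ++ M') N ↭ cross M N ++ cross M' N
  cross-++ˡ M M' [] = ↭-refl
  cross-++ˡ M M' (i ∷ N) rewrite map-++ (λ x → (x , i , 1)) M M' =
    ↭-trans (++⁺ˡ (spokes M i ++ spokes M' i) (cross-++ˡ M M' N))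
      (solve 4 (λ a b c d → ((a ⊕ b) ⊕ (c ⊕ d)) ⊜ ((a ⊕ c) ⊕ (b ⊕ d))) ↭-refl
        (spokes M i) (spokes M' i) (cross M N) (cross M' N))
    where open ++-Solver

  cross-∷ˡ : ∀ x M N → cross (x ∷ M) N ↭ map (λ i → (x , i , 1)) N ++ cross M N
  cross-∷ˡ x M [] = ↭-refl
  cross-∷ˡ x M (i ∷ N) = prep (x , i , 1) (↭-trans (++⁺ˡ (spokes M i) (cross-∷ˡ x M N))
    (solve 3 (λ a b c → (a ⊕ (b ⊕ c)) ⊜ (b ⊕ (a ⊕ c))) ↭-refl
      (spokes M i) (map (λ j → (x , j , 1)) N) (cross M N)))
    where open ++-Solver

  star-split : ∀ u v a b I R → hub u a I ++ hub v b I ++ R ↭ R ++ star u v a b I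
  star-split u v a b I R = ↭-trans
    (solve 3 (λ p q r → (p ⊕ (q ⊕ r)) ⊜ (r ⊕ (p ⊕ q))) ↭-refl (hub u a I) (hub v b I) R)
    (++⁺ˡ R (interleave I))
    where
    open ++-Solver
    interleave : ∀ I → hub u a I ++ hub v b I ↭ star u v a b I
    interleave [] = ↭-refl
    interleave (i ∷ I) = prep (u , i , a)
      (↭-trans (shift (v , i , b) (hub u a I) (hub v b I)) (prep (v , i , b) (interleave I)))

-- The Boolean tells whether a node is a join: `opt` selects the vertices linked across its parts
-- and `scale` does the same for numbers, so both labels share one proof.
opt : {A : Set} → Bool → List A → List A
opt b xs = if b then xs else []

scale : Bool → ℕ → ℕ
scale b n = if b then n else 0

length-opt : {A : Set} → ∀ b (xs : List A) → length (opt b xs) ≡ scale b (length xs)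
length-opt true _ = refl
length-opt false _ = refl

scale-0 : ∀ b → scale b 0 ≡ 0
scale-0 true = refl
scale-0 false = refl

scale-+ : ∀ b m n → scale b (m + n) ≡ scale b m + scale b n
scale-+ true _ _ = refl
scale-+ false _ _ = refl

∈⇒nonZero : {A : Set} {x : A} {xs : List A} → x ∈ xs → NonZero (length xs)
∈⇒nonZero (here _) = _
∈⇒nonZero (there _) = _

All-opt : {A : Set} {P : A → Set} → ∀ b {xs : List A} → All P xs → All P (opt b xs)
All-opt true p = p
All-opt false _ = []

module Modules {V : Set} (_≟_ : DecidableEquality V) (vs : List V) where
  open WeightedCount _≟_
  open Twins _≟_ vs
  open DecMembership _≟_ using (_∈?_)
  private module ++-Solver = CommutativeMonoidSolver (++-commutativeMonoid {A = WEdge V})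

  private variable
    f g : V → V
    M M' N : List V
    E E' R X : List (WEdge V)

  ≈-loops : (P : V → Set) → (∀ {x y} → P x → P y → f x ≡ f y) →
    All (λ (p , q , _) → P p × P q) E → _⊢_≈_ vs f (E ++ X) X
  ≈-loops P same [] = ≈-refl vs
  ≈-loops P same ((p , q) ∷ ps) = ≈-trans vs (≈-loop vs (same p q)) (≈-loops P same ps)

  ≈-spokes : ∀ {m i} → All (λ x → f x ≡ f m) M → _⊢_≈_ vs f (spokes M i ++ X) ((m , i , length M) ∷ X)
  -- An edge of weight 0 is created to start the accumulation of parallel edges.
  ≈-spokes [] = ≈-sym vs (≈-null vs)
  ≈-spokes {m = m} {i} (e ∷ es) =
    ≈-trans vs (≈-relabel vs e refl)
      (≈-trans vs (≈-cons vs (m , i , 1) (≈-spokes es)) (≈-parallel vs))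

  ≈-cross : ∀ {m} → All (λ x → f x ≡ f m) M → ∀ N →
    _⊢_≈_ vs f (cross M N ++ X) (hub m (length M) N ++ X)
  ≈-cross es [] = ≈-refl vs
  ≈-cross {M = M} {X} {m = m} es (i ∷ N) rewrite ++-assoc (spokes M i) (cross M N) X =
    ≈-trans vs (≈-spokes es) (≈-cons vs (m , i , length M) (≈-cross es N))

  ≈-hub : ∀ {m a n} → All (λ x → f x ≡ f n) N →
    _⊢_≈_ vs f (hub m a N ++ X) ((m , n , a * length N) ∷ X)
  ≈-hub {a = a} [] rewrite *-zeroʳ a = ≈-sym vs (≈-null vs)
  ≈-hub {N = i ∷ N} {X} {m = m} {a} {n} (e ∷ es) rewrite *-suc a (length N) =
    ≈-trans vs (≈-relabel vs refl e) (≈-trans vs (≈-cons vs (m , n , a) (≈-hub es)) (≈-parallel vs))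

  ≈-link : ∀ {m n} b → All (λ x → f x ≡ f m) M → All (λ x → f x ≡ f n) N →
    _⊢_≈_ vs f (cross M (opt b N) ++ X) ((m , n , scale b (length M * length N)) ∷ X)
  ≈-link {N = N} true em en = ≈-trans vs (≈-cross em N) (≈-hub en)
  ≈-link false em en = ≈-sym vs (≈-null vs)

  ≈-flip-spokes : ∀ i N → _⊢_≈_ vs f (map (λ j → (i , j , 1)) N ++ X) (spokes N i ++ X)
  ≈-flip-spokes i [] = ≈-refl vs
  ≈-flip-spokes i (j ∷ N) = ≈-trans vs (≈-flip vs) (≈-cons vs (j , i , 1) (≈-flip-spokes i N))

  ≈-cross-comm : ∀ M N → _⊢_≈_ vs f (cross M N ++ X) (cross N M ++ X)
  ≈-cross-comm {X = X} M [] = ≈-perm vs (++⁺ʳ X (empty M))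
    where
    empty : ∀ M → [] ↭ cross [] M
    empty [] = ↭-refl
    empty (_ ∷ M) = empty M
  ≈-cross-comm {X = X} M (i ∷ N) rewrite ++-assoc (spokes M i) (cross M N) X =
    ≈-trans vs (≈-++ˡ vs (spokes M i) (≈-cross-comm M N))
      (≈-trans vs (≈-sym vs (≈-flip-spokes i M))
        (≈-perm vs (↭-trans
          (solve 3 (λ a b c → (a ⊕ (b ⊕ c)) ⊜ ((a ⊕ b) ⊕ c)) ↭-refl (map (λ j → (i , j , 1)) M) (cross N M) X)
          (++⁺ʳ X (↭-sym (cross-∷ˡ i N M))))))
    where open ++-Solver

  -- A `Module` expects its outer edges as `cross M N`, directed outwards. The links between two
  -- parts must therefore be readable from either side.
  ≈-link-comm : ∀ b M N → _⊢_≈_ vs f (cross M (opt b N) ++ X) (cross N (opt b M) ++ X)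
  ≈-link-comm true M N = ≈-cross-comm M N
  ≈-link-comm false M N = ≈-refl vs

  Isolated : (V → V) → List V → Set
  Isolated f M = ∀ {x y} → x ∈ M → f x ≡ f y → x ≡ y

  -- The fields fix the partition of `g` but not its values, so any composite of contractions with
  -- the right fibres qualifies.
  record Merges (f : V → V) (M : List V) (g : V → V) : Set where
    field
      coarser  : f ≼ g
      together : ∀ {x y} → x ∈ M → y ∈ M → g x ≡ g y
      only     : ∀ {x y} → g x ≡ g y → f x ≡ f y ⊎ (x ∈ M × y ∈ M)
  open Merges

  merge : (V → V) → V → List V → V → V
  merge f m M x = if does (x ∈? M) then f m else f x

  -- The new class takes the name `f m` of a vertex of `M`; by isolation no vertex outside `M` bears
  -- it.
  merge-merges : ∀ {m} → m ∈ M → Isolated f M → Merges f M (merge f m M)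
  merge-merges {M = M} {f} {m} m∈ iso = record
    { coarser = coarser' ; together = together' ; only = only' }
    where
    inside : ∀ {x} → x ∈ M → merge f m M x ≡ f m
    inside {x} x∈ rewrite dec-true (x ∈? M) x∈ = refl
    together' : ∀ {x y} → x ∈ M → y ∈ M → merge f m M x ≡ merge f m M y
    together' x∈ y∈ = trans (inside x∈) (sym (inside y∈))
    coarser' : f ≼ merge f m M
    coarser' x y e with x ∈? M | y ∈? M
    ... | yes _ | yes _ = refl
    ... | no _ | no _ = e
    ... | yes x∈ | no y∉ = ⊥-elim (y∉ (subst (_∈ M) (iso x∈ e) x∈))
    ... | no x∉ | yes y∈ = ⊥-elim (x∉ (subst (_∈ M) (iso y∈ (sym e)) y∈))
    only' : ∀ {x y} → merge f m M x ≡ merge f m M y → f x ≡ f y ⊎ (x ∈ M × y ∈ M)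
    only' {x} {y} e with x ∈? M | y ∈? M
    ... | yes x∈ | yes y∈ = inj₂ (x∈ , y∈)
    ... | no _ | no _ = inj₁ e
    ... | yes _ | no y∉ = ⊥-elim (y∉ (subst (_∈ M) (iso m∈ e) m∈))
    ... | no x∉ | yes _ = ⊥-elim (x∉ (subst (_∈ M) (iso m∈ (sym e)) m∈))

  -- E are the edges inside M; R stands for the edges avoiding M, and N for the
  -- common outside neighbours of M, so merging M costs a factor q |N| / |M|.
  record Module (M : List V) (E : List (WEdge V)) (q : ℕ → ℕ) : Set where
    field
      element    : V
      element-∈  : element ∈ M
      inside     : All (λ (x , y , _) → x ∈ M × y ∈ M) E
      merge-count : ∀ {f g N R} → All (_∈ vs) M → All (_∈ vs) N → Isolated f M → Merges f M g →
        All (_∉ M) N → All (λ (x , y , _) → x ∉ M × y ∉ M) R →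
        length M * τ vs f (E ++ cross M N ++ R) ≡ q (length N) * τ vs g (E ++ cross M N ++ R)
  open Module

  singleton-module : ∀ v → Module (v ∷ []) [] (λ _ → 1)
  singleton-module v = record
    { element = v ; element-∈ = here refl ; inside = []
    ; merge-count = λ _ _ _ mg _ _ → cong (1 *_) (τ-resp vs (coarser mg)
        (λ { x y e → finer mg (only mg e) }) _) }
    where
    finer : Merges f (v ∷ []) g → ∀ {x y} → f x ≡ f y ⊎ (x ∈ v ∷ [] × y ∈ v ∷ []) → f x ≡ f y
    finer _ (inj₁ e) = e
    finer _ (inj₂ (here refl , here refl)) = refl

  module _ {M₁ M₂ E₁ E₂ q₁ q₂} (b : Bool) (mod₁ : Module M₁ E₁ q₁) (mod₂ : Module M₂ E₂ q₂)
    (disjoint : ∀ {x} → x ∈ M₁ → x ∉ M₂) where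

    private
      m₁ = element mod₁
      m₂ = element mod₂
      n₁ = length M₁
      n₂ = length M₂
      L L' : List (WEdge V)
      L = cross M₁ (opt b M₂)
      L' = cross M₂ (opt b M₁)

    Disjoint-opt : (M N : List V) → (∀ {x} → x ∈ M → x ∉ N) → All (_∉ N) (opt b M)
    Disjoint-opt M N d = All-opt b (All.tabulate d)

    cross-∈ : (M N : List V) → All (λ (x , y , _) → x ∈ M × y ∈ N) (cross M N)
    cross-∈ M [] = []
    cross-∈ M (i ∷ N) = All.++⁺ (All.map⁺ (All.tabulate (λ x∈ → x∈ , here refl)))
      (All.map (λ (p , q) → p , there q) (cross-∈ M N))

    -- If the parts are joined, each is an outside neighbourhood of the other, hence the shifted
    -- arguments of `q₁` and `q₂`. The last factor is the degree of the cotree node.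
    join-coefficient : ℕ → ℕ
    join-coefficient W = q₁ (W + scale b n₂) * q₂ (W + scale b n₁) * (W + scale b (n₁ + n₂))

    -- Three merges in a row: `M₁` leads from `f` to `g₁`, `M₂` to `g₂`, and `twins` for the two
    -- remaining vertices to `g`. While one part is merged, the inner and outer edges of the other
    -- belong to the surroundings `R`.
    join-count : ∀ {f g N R} → All (_∈ vs) (M₁ ++ M₂) → All (_∈ vs) N → Isolated f (M₁ ++ M₂) →
      Merges f (M₁ ++ M₂) g → All (_∉ M₁ ++ M₂) N →
      All (λ (x , y , _) → x ∉ M₁ ++ M₂ × y ∉ M₁ ++ M₂) R →
      let F = (E₁ ++ E₂ ++ L) ++ cross (M₁ ++ M₂) N ++ R in
      length (M₁ ++ M₂) * τ vs f F ≡ join-coefficient (length N) * τ vs g F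
    join-count {f} {g} {N} {R} M∈ N∈ iso mg N∉ R∉ = result
      where
      open ≡-Reasoning
      C₁ C₂ Y F X₁ X₂ : List (WEdge V)
      C₁ = cross M₁ N
      C₂ = cross M₂ N
      Y = R ++ star m₁ m₂ n₁ n₂ N
      F = (E₁ ++ E₂ ++ L) ++ cross (M₁ ++ M₂) N ++ R
      X₁ = E₁ ++ cross M₁ (N ++ opt b M₂) ++ E₂ ++ C₂ ++ R
      X₂ = E₂ ++ cross M₂ (N ++ opt b M₁) ++ E₁ ++ C₁ ++ R

      F↭ : F ↭ (E₁ ++ E₂ ++ L) ++ (C₁ ++ C₂) ++ R
      F↭ = ++⁺ˡ (E₁ ++ E₂ ++ L) (++⁺ʳ R (cross-++ˡ M₁ M₂ N))

      -- `X₁` and `X₂` are the same edges sorted from the viewpoint of each part, in the shape that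
      -- `merge-count` requires.
      F≈X₁ : _⊢_≈_ vs f F X₁
      F≈X₁ rewrite cross-++ʳ M₁ N (opt b M₂) = ≈-perm vs (↭-trans F↭
        (solve 6 (λ e₁ e₂ l c₁ c₂ r → ((e₁ ⊕ (e₂ ⊕ l)) ⊕ ((c₁ ⊕ c₂) ⊕ r)) ⊜ (e₁ ⊕ ((c₁ ⊕ l) ⊕ (e₂ ⊕ (c₂ ⊕ r)))))
          ↭-refl E₁ E₂ L C₁ C₂ R))
        where open ++-Solver

      F≈X₂ : _⊢_≈_ vs f F X₂
      F≈X₂ rewrite cross-++ʳ M₂ N (opt b M₁) =
        ≈-trans vs (≈-perm vs (↭-trans F↭
          (solve 6 (λ e₁ e₂ l c₁ c₂ r → ((e₁ ⊕ (e₂ ⊕ l)) ⊕ ((c₁ ⊕ c₂) ⊕ r)) ⊜ (l ⊕ (e₁ ⊕ (e₂ ⊕ (c₁ ⊕ (c₂ ⊕ r))))))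
            ↭-refl E₁ E₂ L C₁ C₂ R)))
        (≈-trans vs (≈-link-comm b M₁ M₂) (≈-perm vs
          (solve 6 (λ e₁ e₂ l c₁ c₂ r → (l ⊕ (e₁ ⊕ (e₂ ⊕ (c₁ ⊕ (c₂ ⊕ r))))) ⊜ (e₂ ⊕ ((c₂ ⊕ l) ⊕ (e₁ ⊕ (c₁ ⊕ r)))))
            ↭-refl E₁ E₂ L' C₁ C₂ R)))
        where open ++-Solver

      M₁∈ : All (_∈ vs) M₁
      M₁∈ = proj₁ (All.++⁻ M₁ M∈)
      M₂∈ : All (_∈ vs) M₂
      M₂∈ = proj₂ (All.++⁻ M₁ M∈)
      iso₁ : Isolated f M₁
      iso₁ x∈ = iso (∈-++⁺ˡ x∈)
      iso₂ : Isolated f M₂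
      iso₂ x∈ = iso (∈-++⁺ʳ M₁ x∈)

      g₁ g₂ : V → V
      g₁ = merge f m₁ M₁
      mg₁ : Merges f M₁ g₁
      mg₁ = merge-merges (element-∈ mod₁) iso₁
      iso₂' : Isolated g₁ M₂
      iso₂' x∈ e with only mg₁ e
      ... | inj₁ e' = iso₂ x∈ e'
      ... | inj₂ (x∈₁ , _) = ⊥-elim (disjoint x∈₁ x∈)
      g₂ = merge g₁ m₂ M₂
      mg₂ : Merges g₁ M₂ g₂
      mg₂ = merge-merges (element-∈ mod₂) iso₂'
      f≼g₁ : f ≼ g₁
      f≼g₁ = coarser mg₁
      f≼g₂ : f ≼ g₂
      f≼g₂ = ≼-trans f≼g₁ (coarser mg₂)

      count₁ : n₁ * τ vs f F ≡ q₁ (length (N ++ opt b M₂)) * τ vs g₁ F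
      count₁ = begin
        n₁ * τ vs f F    ≡⟨ cong (n₁ *_) (≈-at vs F≈X₁) ⟩
        n₁ * τ vs f X₁   ≡⟨ merge-count mod₁ M₁∈ (All.++⁺ N∈ (All-opt b M₂∈)) iso₁ mg₁
            (All.++⁺ (All.map (λ ∉M ∈M₁ → ∉M (∈-++⁺ˡ ∈M₁)) N∉)
              (Disjoint-opt M₂ M₁ (λ x∈₂ x∈₁ → disjoint x∈₁ x∈₂)))
            (All.++⁺ (All.map (λ (x∈ , y∈) → (λ x∈₁ → disjoint x∈₁ x∈) , (λ y∈₁ → disjoint y∈₁ y∈)) (inside mod₂))
              (All.++⁺ (All.map (λ (x∈ , y∈) → (λ x∈₁ → disjoint x∈₁ x∈) ,
                           (λ y∈₁ → All.lookup N∉ y∈ (∈-++⁺ˡ y∈₁))) (cross-∈ M₂ N))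
                (All.map (λ (x∉ , y∉) → (λ x∈ → x∉ (∈-++⁺ˡ x∈)) , (λ y∈ → y∉ (∈-++⁺ˡ y∈))) R∉))) ⟩
        q₁ (length (N ++ opt b M₂)) * τ vs g₁ X₁ ≡⟨ cong (q₁ (length (N ++ opt b M₂)) *_) (F≈X₁ g₁ f≼g₁) ⟨
        q₁ (length (N ++ opt b M₂)) * τ vs g₁ F ∎

      count₂ : n₂ * τ vs g₁ F ≡ q₂ (length (N ++ opt b M₁)) * τ vs g₂ F
      count₂ = begin
        n₂ * τ vs g₁ F    ≡⟨ cong (n₂ *_) (F≈X₂ g₁ f≼g₁) ⟩
        n₂ * τ vs g₁ X₂   ≡⟨ merge-count mod₂ M₂∈ (All.++⁺ N∈ (All-opt b M₁∈)) iso₂' mg₂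
            (All.++⁺ (All.map (λ ∉M ∈M₂ → ∉M (∈-++⁺ʳ M₁ ∈M₂)) N∉) (Disjoint-opt M₁ M₂ disjoint))
            (All.++⁺ (All.map (λ (x∈ , y∈) → disjoint x∈ , disjoint y∈) (inside mod₁))
              (All.++⁺ (All.map (λ (x∈ , y∈) → disjoint x∈ ,
                           (λ y∈₂ → All.lookup N∉ y∈ (∈-++⁺ʳ M₁ y∈₂))) (cross-∈ M₁ N))
                (All.map (λ (x∉ , y∉) → (λ x∈ → x∉ (∈-++⁺ʳ M₁ x∈)) , (λ y∈ → y∉ (∈-++⁺ʳ M₁ y∈))) R∉))) ⟩
        q₂ (length (N ++ opt b M₁)) * τ vs g₂ X₂ ≡⟨ cong (q₂ (length (N ++ opt b M₁)) *_) (F≈X₂ g₂ f≼g₂) ⟨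
        q₂ (length (N ++ opt b M₁)) * τ vs g₂ F ∎

      together₁ : ∀ {x y} → x ∈ M₁ → y ∈ M₁ → g₂ x ≡ g₂ y
      together₁ x∈ y∈ = coarser mg₂ _ _ (together mg₁ x∈ y∈)
      together₂ : ∀ {x y} → x ∈ M₂ → y ∈ M₂ → g₂ x ≡ g₂ y
      together₂ = together mg₂

      -- Under `g₂` the inner edges of both parts are loops, the links collapse to one edge, of
      -- weight 0 for a union, and the edges to `N` form a star with weights `n₁` and `n₂`.
      F≈Y : _⊢_≈_ vs g₂ F ((m₁ , m₂ , scale b (n₁ * n₂)) ∷ Y)
      F≈Y =
        ≈-trans vs (≈-perm vs (↭-trans F↭
          (solve 6 (λ e₁ e₂ l c₁ c₂ r → ((e₁ ⊕ (e₂ ⊕ l)) ⊕ ((c₁ ⊕ c₂) ⊕ r)) ⊜ (e₁ ⊕ (e₂ ⊕ (l ⊕ (c₁ ⊕ (c₂ ⊕ r))))))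
            ↭-refl E₁ E₂ L C₁ C₂ R)))
        (≈-trans vs (≈-loops (_∈ M₁) together₁ (inside mod₁))
        (≈-trans vs (≈-loops (_∈ M₂) together₂ (inside mod₂))
        (≈-trans vs (≈-link b all₁ all₂) (≈-cons vs (m₁ , m₂ , scale b (n₁ * n₂))
        (≈-trans vs (≈-cross all₁ N)
        (≈-trans vs (≈-++ˡ vs (hub m₁ n₁ N) (≈-cross all₂ N))
        (≈-perm vs (star-split m₁ m₂ n₁ n₂ N R))))))))
        where
        open ++-Solver
        all₁ : All (λ x → g₂ x ≡ g₂ m₁) M₁
        all₁ = All.tabulate (λ x∈ → together₁ x∈ (element-∈ mod₁))
        all₂ : All (λ x → g₂ x ≡ g₂ m₂) M₂
        all₂ = All.tabulate (λ x∈ → together₂ x∈ (element-∈ mod₂))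

      apart : ∀ {x m} → x ∉ M₁ ++ M₂ → m ∈ M₁ ++ M₂ → g₂ x ≢ g₂ m
      apart x∉ m∈ e with only mg₂ e
      ... | inj₂ (x∈ , _) = x∉ (∈-++⁺ʳ M₁ x∈)
      ... | inj₁ e' with only mg₁ e'
      ...   | inj₂ (x∈ , _) = x∉ (∈-++⁺ˡ x∈)
      ...   | inj₁ e'' = x∉ (subst (_∈ M₁ ++ M₂) (iso m∈ (sym e'')) m∈)
      m₁∈ : m₁ ∈ M₁ ++ M₂
      m₁∈ = ∈-++⁺ˡ (element-∈ mod₁)
      m₂∈ : m₂ ∈ M₁ ++ M₂
      m₂∈ = ∈-++⁺ʳ M₁ (element-∈ mod₂)
      m₁≁m₂ : g₂ m₁ ≢ g₂ m₂
      m₁≁m₂ e with only mg₂ e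
      ... | inj₂ (∈₂ , _) = disjoint (element-∈ mod₁) ∈₂
      ... | inj₁ e' = disjoint (element-∈ mod₁) (subst (_∈ M₂) (iso₂' (element-∈ mod₂) (sym e')) (element-∈ mod₂))

      h≼g : contract g₂ m₁ m₂ ≼ g
      h≼g = contract-least g₂≼g (together mg m₁∈ m₂∈)
        where
        g₂≼g : g₂ ≼ g
        g₂≼g x y e with only mg₂ e
        ... | inj₂ (x∈ , y∈) = together mg (∈-++⁺ʳ M₁ x∈) (∈-++⁺ʳ M₁ y∈)
        ... | inj₁ e' with only mg₁ e'
        ...   | inj₂ (x∈ , y∈) = together mg (∈-++⁺ˡ x∈) (∈-++⁺ˡ y∈)
        ...   | inj₁ e'' = coarser mg x y e''
      g≼h : g ≼ contract g₂ m₁ m₂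
      g≼h x y e with only mg e
      ... | inj₁ e' = contract-≽ g₂ m₁ m₂ x y (f≼g₂ x y e')
      ... | inj₂ (x∈ , y∈) = trans (to-m₁ x∈) (sym (to-m₁ y∈))
        where
        h : V → V
        h = contract g₂ m₁ m₂
        to-m₁ : ∀ {z} → z ∈ M₁ ++ M₂ → h z ≡ h m₁
        to-m₁ z∈ with ∈-++⁻ M₁ z∈
        ... | inj₁ z∈₁ = contract-≽ g₂ m₁ m₂ _ _ (together₁ z∈₁ (element-∈ mod₁))
        ... | inj₂ z∈₂ = trans (contract-≽ g₂ m₁ m₂ _ _ (together₂ z∈₂ (element-∈ mod₂)))
                           (sym (contract-join g₂ m₁ m₂))

      -- Deleting the link leaves the case of `twins` and yields the summand `length N`; contracting
      -- it yields its weight times `n₁ + n₂`. This is how the vertices inside a join enter its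
      -- degree.
      count₃ : (n₁ + n₂) * τ vs g₂ F ≡ n₁ * n₂ * (length N + scale b (n₁ + n₂)) * τ vs g F
      count₃ = begin
        (n₁ + n₂) * τ vs g₂ F    ≡⟨ cong ((n₁ + n₂) *_) (trans (≈-at vs F≈Y) (τ-edge m₁≁m₂)) ⟩
        (n₁ + n₂) * (τ vs g₂ Y + c * H)           ≡⟨ dist (n₁ + n₂) (τ vs g₂ Y) c H ⟩
        (n₁ + n₂) * τ vs g₂ Y + (n₁ + n₂) * c * H
          ≡⟨ cong (_+ (n₁ + n₂) * c * H) (twins m₁ m₂ n₁ n₂ {f = g₂} (All.lookup M₁∈ (element-∈ mod₁))
               (All.lookup M₂∈ (element-∈ mod₂)) m₁≁m₂ R N N∈
               (All.map (λ (x∉ , y∉) → (apart x∉ m₁∈ , apart x∉ m₂∈) , (apart y∉ m₁∈ , apart y∉ m₂∈)) R∉)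
               (All.map (λ x∉ → apart x∉ m₁∈ , apart x∉ m₂∈) N∉)) ⟩
        n₁ * n₂ * length N * H + (n₁ + n₂) * c * H   ≡⟨ factor b n₁ n₂ (length N) H ⟩
        n₁ * n₂ * (length N + scale b (n₁ + n₂)) * H
          -- The link is a loop after the contraction and may be put back, so that `F≈Y` can be read
          -- in reverse.
          ≡⟨ cong (n₁ * n₂ * (length N + scale b (n₁ + n₂)) *_) (trans (sym (τ-loop (contract-join g₂ m₁ m₂)))
               (trans (sym (F≈Y (contract g₂ m₁ m₂) (contract-≽ g₂ m₁ m₂))) (τ-resp vs h≼g g≼h F))) ⟩
        n₁ * n₂ * (length N + scale b (n₁ + n₂)) * τ vs g F ∎
        where
        c = scale b (n₁ * n₂)
        H = τ vs (contract g₂ m₁ m₂) Y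
        dist : ∀ s x c y → s * (x + c * y) ≡ s * x + s * c * y
        dist = solve-∀
        factor : ∀ b n₁ n₂ k H → n₁ * n₂ * k * H + (n₁ + n₂) * scale b (n₁ * n₂) * H
          ≡ n₁ * n₂ * (k + scale b (n₁ + n₂)) * H
        factor true = arith
          where
          arith : ∀ n₁ n₂ k H → n₁ * n₂ * k * H + (n₁ + n₂) * (n₁ * n₂) * H ≡ n₁ * n₂ * (k + (n₁ + n₂)) * H
          arith = solve-∀
        factor false = arith
          where
          arith : ∀ n₁ n₂ k H → n₁ * n₂ * k * H + (n₁ + n₂) * 0 * H ≡ n₁ * n₂ * (k + 0) * H
          arith = solve-∀

      result : length (M₁ ++ M₂) * τ vs f F ≡ join-coefficient (length N) * τ vs g F
      -- The factors `n₁` and `n₂` produced by `twins` cancel the denominators of the first two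
      -- merges; the `element` of each module makes them nonzero.
      result = *-cancelˡ-≡ _ _ n₁ {{∈⇒nonZero (element-∈ mod₁)}} (*-cancelˡ-≡ _ _ n₂ {{∈⇒nonZero (element-∈ mod₂)}} (begin
        n₂ * (n₁ * (length (M₁ ++ M₂) * τ vs f F))
          ≡⟨ cong (λ x → n₂ * (n₁ * (x * τ vs f F))) (length-++ M₁) ⟩
        n₂ * (n₁ * ((n₁ + n₂) * τ vs f F))        ≡⟨ r₁ n₁ n₂ (n₁ + n₂) (τ vs f F) ⟩
        (n₁ + n₂) * (n₂ * (n₁ * τ vs f F))        ≡⟨ cong (λ x → (n₁ + n₂) * (n₂ * x)) count₁' ⟩
        (n₁ + n₂) * (n₂ * (Q₁ * τ vs g₁ F))       ≡⟨ r₄ Q₁ n₂ (n₁ + n₂) (τ vs g₁ F) ⟩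
        Q₁ * ((n₁ + n₂) * (n₂ * τ vs g₁ F))       ≡⟨ cong (λ x → Q₁ * ((n₁ + n₂) * x)) count₂' ⟩
        Q₁ * ((n₁ + n₂) * (Q₂ * τ vs g₂ F))       ≡⟨ r₂ Q₁ (n₁ + n₂) Q₂ (τ vs g₂ F) ⟩
        Q₁ * Q₂ * ((n₁ + n₂) * τ vs g₂ F)         ≡⟨ cong (Q₁ * Q₂ *_) count₃ ⟩
        Q₁ * Q₂ * (n₁ * n₂ * D * τ vs g F)        ≡⟨ r₃ Q₁ Q₂ n₁ n₂ D (τ vs g F) ⟩
        n₂ * (n₁ * (Q₁ * Q₂ * D * τ vs g F)) ∎))
        where
        Q₁ = q₁ (length N + scale b n₂)
        Q₂ = q₂ (length N + scale b n₁)
        D = length N + scale b (n₁ + n₂)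
        degree : ∀ M → length (N ++ opt b M) ≡ length N + scale b (length M)
        degree M = trans (length-++ N) (cong (length N +_) (length-opt b M))
        count₁' : n₁ * τ vs f F ≡ Q₁ * τ vs g₁ F
        count₁' = trans count₁ (cong (λ x → q₁ x * τ vs g₁ F) (degree M₂))
        count₂' : n₂ * τ vs g₁ F ≡ Q₂ * τ vs g₂ F
        count₂' = trans count₂ (cong (λ x → q₂ x * τ vs g₂ F) (degree M₁))
        r₁ : ∀ a b s t → b * (a * (s * t)) ≡ s * (b * (a * t))
        r₁ = solve-∀
        r₂ : ∀ a s b t → a * (s * (b * t)) ≡ a * b * (s * t)
        r₂ = solve-∀
        r₃ : ∀ a b m n d t → a * b * (m * n * d * t) ≡ n * (m * (a * b * d * t))
        r₃ = solve-∀
        r₄ : ∀ a b s t → s * (b * (a * t)) ≡ a * (s * (b * t))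
        r₄ = solve-∀

    join-module : Module (M₁ ++ M₂) (E₁ ++ E₂ ++ L) join-coefficient
    join-module = record
      { element = m₁ ; element-∈ = ∈-++⁺ˡ (element-∈ mod₁)
      ; inside = All.++⁺ (All.map (λ (p , q) → ∈-++⁺ˡ p , ∈-++⁺ˡ q) (inside mod₁))
          (All.++⁺ (All.map (λ (p , q) → ∈-++⁺ʳ M₁ p , ∈-++⁺ʳ M₁ q) (inside mod₂))
            (links b))
      ; merge-count = join-count }
      where
      links : ∀ b → All (λ (x , y , _) → x ∈ M₁ ++ M₂ × y ∈ M₁ ++ M₂) (cross M₁ (opt b M₂))
      links true = All.map (λ (p , q) → ∈-++⁺ˡ p , ∈-++⁺ʳ M₁ q) (cross-∈ M₁ M₂)
      links false = []

-- The modules of a cotree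

isJoinLabel : Label → Bool
isJoinLabel l = isJoin (just l)

leafCount : List Cotree → ℕ
leafCount [] = 0
leafCount (c ∷ cs) = nV c + leafCount cs

length-leavesF : ∀ k cs → length (leavesF k cs) ≡ leafCount cs
length-leavesF k [] = refl
length-leavesF k (c ∷ cs) = trans (length-++ (map (k ∷_) (leavesT c)))
  (cong₂ _+_ (length-map (k ∷_) (leavesT c)) (length-leavesF (suc k) cs))

-- In degreeProduct W t the number W counts the outside vertices adjacent to
-- every leaf of t.
mutual
  degreeProduct : ℕ → Cotree → ℕ
  degreeProduct W leaf = 1
  degreeProduct W (node l cs) =
    (W + scale (isJoinLabel l) (leafCount cs)) ^ (length cs ∸ 1) * degreeProductF (isJoinLabel l) W cs

  -- `W` has absorbed the children already passed and `leafCount cs` adds those still to come, so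
  -- under a join each child sees the leaves of all its siblings.
  degreeProductF : Bool → ℕ → List Cotree → ℕ
  degreeProductF b W [] = 1
  degreeProductF b W (c ∷ cs) =
    degreeProduct (W + scale b (leafCount cs)) c * degreeProductF b (W + scale b (nV c)) cs

module _ {V : Set} where
  mutual
    -- Leaves of a subtree have paths relative to it; `φ` restores the prefix from the root.
    edgesT : (Path → V) → Cotree → List (WEdge V)
    edgesT φ leaf = []
    edgesT φ (node l cs) = edgesF φ (isJoinLabel l) 0 cs

    edgesF : (Path → V) → Bool → ℕ → List Cotree → List (WEdge V)
    edgesF φ b k [] = []
    edgesF φ b k (c ∷ cs) = edgesT (φ ∘ (k ∷_)) c ++ edgesF φ b (suc k) cs ++
      cross (map (φ ∘ (k ∷_)) (leavesT c)) (opt b (map φ (leavesF (suc k) cs)))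

  map-leavesF-∷ : (φ : Path → V) → ∀ k c cs →
    map φ (leavesF k (c ∷ cs)) ≡ map (φ ∘ (k ∷_)) (leavesT c) ++ map φ (leavesF (suc k) cs)
  map-leavesF-∷ φ k c cs = trans (map-++ φ (map (k ∷_) (leavesT c)) (leavesF (suc k) cs))
    (cong (_++ map φ (leavesF (suc k) cs)) (sym (map-∘ (leavesT c))))

HeadFrom : ℕ → Path → Set
HeadFrom k v = ∃ λ a → ∃ λ p → v ≡ a ∷ p × k ≤ a

leavesF-head : ∀ k cs → All (HeadFrom k) (leavesF k cs)
leavesF-head k [] = []
leavesF-head k (c ∷ cs) = All.++⁺ (All.map⁺ (All.universal (λ p → k , p , refl , ≤-refl) (leavesT c)))
  (All.map (λ (a , p , e , le) → a , p , e , ≤-trans (m≤n⇒m≤1+n ≤-refl) le) (leavesF-head (suc k) cs))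

module _ {V : Set} (_≟_ : DecidableEquality V) (vs : List V) where
  open Modules _≟_ vs

  resp-module : ∀ {M M' : List V} {E E' q q'} → M ≡ M' → E ≡ E' → (∀ W → q W ≡ q' W) →
    Module M E q → Module M' E' q'
  resp-module {E = E} refl refl q≡q' m = record
    { element = element ; element-∈ = element-∈ ; inside = inside
    ; merge-count = λ {f} {g} {N} {R} a b c d e r →
        trans (merge-count a b c d e r) (cong (_* WeightedCount.τ _≟_ vs g (E ++ cross _ N ++ R)) (q≡q' (length N))) }
    where open Module m

  mutual
    tree-module : ∀ {φ} → (∀ {p q} → φ p ≡ φ q → p ≡ q) → ∀ t → WellFormed t →
      Module (map φ (leavesT t)) (edgesT φ t) (λ W → degreeProduct W t)
    tree-module {φ} inj leaf _ = singleton-module (φ [])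
    tree-module inj (node l (c ∷ cs)) (nodeWF _ _ (w ∷ ws)) = forest-module inj (isJoinLabel l) 0 c cs w ws

    -- Splitting off the first child adds its leaves to the outside degree of the rest exactly when
    -- they leave the forest. The sum `W + scale b (leafCount (c ∷ cs))` is therefore the same at
    -- every split, and it collects into one power.
    forest-module : ∀ {φ} → (∀ {p q} → φ p ≡ φ q → p ≡ q) → ∀ b k c cs → WellFormed c → All WellFormed cs →
      Module (map φ (leavesF k (c ∷ cs))) (edgesF φ b k (c ∷ cs))
        (λ W → (W + scale b (leafCount (c ∷ cs))) ^ length cs * degreeProductF b W (c ∷ cs))
    forest-module {φ} inj b k c [] w [] = resp-module
      (sym (trans (map-leavesF-∷ φ k c []) (++-identityʳ _)))
      (sym (trans (cong (edgesT (φ ∘ (k ∷_)) c ++_) (no-cross b)) (++-identityʳ _)))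
      (λ W → trans (cong (λ x → degreeProduct x c) (sym (trans (cong (W +_) (scale-0 b)) (+-identityʳ W))))
        (sym (trans (*-identityˡ _) (*-identityʳ _))))
      (tree-module (∷-injectiveʳ ∘ inj) c w)
      where
      no-cross : ∀ b → cross (map (φ ∘ (k ∷_)) (leavesT c)) (opt b []) ≡ []
      no-cross true = refl
      no-cross false = refl
    forest-module {φ} inj b k c (c' ∷ cs) w (w' ∷ ws) = resp-module
      (sym (map-leavesF-∷ φ k c (c' ∷ cs))) refl coefficient
      (join-module b (tree-module (∷-injectiveʳ ∘ inj) c w) (forest-module inj b (suc k) c' cs w' ws) disjoint)
      where
      disjoint : ∀ {x} → x ∈ map (φ ∘ (k ∷_)) (leavesT c) → x ∉ map φ (leavesF (suc k) (c' ∷ cs))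
      disjoint x∈ x∈' with ∈-map⁻ (φ ∘ (k ∷_)) x∈ | ∈-map⁻ φ x∈'
      ... | p , _ , refl | q , q∈ , e with All.lookup (leavesF-head (suc k) (c' ∷ cs)) q∈
      ...   | a , q' , refl , k<a = <⇒≢ k<a (∷-injectiveˡ (inj e))
      n₁ = length (map (φ ∘ (k ∷_)) (leavesT c))
      n₂ = length (map φ (leavesF (suc k) (c' ∷ cs)))
      n₁≡ : n₁ ≡ nV c
      n₁≡ = length-map (φ ∘ (k ∷_)) (leavesT c)
      n₂≡ : n₂ ≡ leafCount (c' ∷ cs)
      n₂≡ = trans (length-map φ (leavesF (suc k) (c' ∷ cs))) (length-leavesF (suc k) (c' ∷ cs))
      coefficient : ∀ W →
        degreeProduct (W + scale b n₂) c
          * ((W + scale b n₁ + scale b (leafCount (c' ∷ cs))) ^ length cs * degreeProductF b (W + scale b n₁) (c' ∷ cs))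
          * (W + scale b (n₁ + n₂))
        ≡ (W + scale b (leafCount (c ∷ c' ∷ cs))) ^ length (c' ∷ cs) * degreeProductF b W (c ∷ c' ∷ cs)
      coefficient W rewrite n₁≡ | n₂≡ | +-assoc W (scale b (nV c)) (scale b (leafCount (c' ∷ cs)))
        | sym (scale-+ b (nV c) (leafCount (c' ∷ cs))) =
        arith (degreeProduct (W + scale b (leafCount (c' ∷ cs))) c)
          ((W + scale b (leafCount (c ∷ c' ∷ cs))) ^ length cs) _ _
        where
        arith : ∀ p x f d → p * (x * f) * d ≡ d * x * (p * f)
        arith = solve-∀

-- Edges of the cograph as pairs of leaves

module _ {A B : Set} where
  filterᵇ-map : (p : B → Bool) (h : A → B) → ∀ xs → filterᵇ p (map h xs) ≡ map h (filterᵇ (p ∘ h) xs)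
  filterᵇ-map p h [] = refl
  filterᵇ-map p h (x ∷ xs) with p (h x)
  ... | true = cong (h x ∷_) (filterᵇ-map p h xs)
  ... | false = filterᵇ-map p h xs

module _ {A : Set} where
  filterᵇ-cong : {p q : A → Bool} → ∀ {xs} → All (λ x → p x ≡ q x) xs → filterᵇ p xs ≡ filterᵇ q xs
  filterᵇ-cong [] = refl
  filterᵇ-cong {p} {q} {x ∷ xs} (e ∷ es) with p x | q x
  filterᵇ-cong {p} {q} {x ∷ xs} (refl ∷ es) | true | _ = cong (x ∷_) (filterᵇ-cong es)
  filterᵇ-cong {p} {q} {x ∷ xs} (refl ∷ es) | false | _ = filterᵇ-cong es

  filterᵇ-const : ∀ b (xs : List A) → filterᵇ (λ _ → b) xs ≡ opt b xs
  filterᵇ-const true [] = refl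
  filterᵇ-const true (x ∷ xs) = cong (x ∷_) (filterᵇ-const true xs)
  filterᵇ-const false [] = refl
  filterᵇ-const false (x ∷ xs) = filterᵇ-const false xs

  unitPairs : List A → List (WEdge A)
  unitPairs [] = []
  unitPairs (x ∷ xs) = map (λ y → (x , y , 1)) xs ++ unitPairs xs

  cross-[]ˡ : ∀ (N : List A) → cross [] N ≡ []
  cross-[]ˡ [] = refl
  cross-[]ˡ (_ ∷ N) = cross-[]ˡ N

  unitPairs-++ : ∀ xs ys → unitPairs (xs ++ ys) ↭ unitPairs xs ++ unitPairs ys ++ cross xs ys
  unitPairs-++ [] ys rewrite cross-[]ˡ ys | ++-identityʳ (unitPairs ys) = ↭-refl
  unitPairs-++ (x ∷ xs) ys rewrite map-++ (λ y → (x , y , 1)) xs ys = ↭-trans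
    (++⁺ˡ (spoke xs ++ spoke ys) (unitPairs-++ xs ys))
    (↭-trans
      (solve 5 (λ a b p q c → ((a ⊕ b) ⊕ (p ⊕ (q ⊕ c))) ⊜ ((a ⊕ p) ⊕ (q ⊕ (b ⊕ c)))) ↭-refl
        (spoke xs) (spoke ys) (unitPairs xs) (unitPairs ys) (cross xs ys))
      (++⁺ˡ (unitPairs (x ∷ xs)) (++⁺ˡ (unitPairs ys) (↭-sym (cross-∷ˡ x xs ys)))))
    where
    open CommutativeMonoidSolver (++-commutativeMonoid {A = WEdge A})
    spoke = map (λ y → (x , y , 1))

mapEdge : {A B : Set} → (A → B) → WEdge A → WEdge B
mapEdge φ (x , y , w) = φ x , φ y , w

module _ {A B : Set} (φ : A → B) where
  unitPairs-map : ∀ xs → map (mapEdge φ) (unitPairs xs) ≡ unitPairs (map φ xs)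
  unitPairs-map [] = refl
  unitPairs-map (x ∷ xs) = trans (map-++ (mapEdge φ) (map (λ y → (x , y , 1)) xs) (unitPairs xs))
    (cong₂ _++_ (trans (sym (map-∘ xs)) (map-∘ xs)) (unitPairs-map xs))

  cross-map : ∀ M N → map (mapEdge φ) (cross M N) ≡ cross (map φ M) (map φ N)
  cross-map M [] = refl
  cross-map M (i ∷ N) = trans (map-++ (mapEdge φ) (spokes M i) (cross M N))
    (cong₂ _++_ (trans (sym (map-∘ M)) (map-∘ M)) (cross-map M N))

labelAt-cong : ∀ t t' p p' → subtreeAt t p ≡ subtreeAt t' p' → labelAt t p ≡ labelAt t' p'
labelAt-cong t t' p p' e rewrite e = refl

numChildren-cong : ∀ t t' p p' → subtreeAt t p ≡ subtreeAt t' p' → numChildren t p ≡ numChildren t' p'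
numChildren-cong t t' p p' e rewrite e = refl

≡ᵇ-refl : ∀ k → (k ≡ᵇ k) ≡ true
≡ᵇ-refl zero = refl
≡ᵇ-refl (suc k) = ≡ᵇ-refl k

≢⇒≡ᵇ-false : ∀ {a b} → a ≢ b → (a ≡ᵇ b) ≡ false
≢⇒≡ᵇ-false {a} {b} ne with a ≡ᵇ b in e
... | false = refl
... | true = ⊥-elim (ne (≡ᵇ⇒≡ a b (subst Bool.T (sym e) _)))

lca-same : ∀ k p q → lca (k ∷ p) (k ∷ q) ≡ k ∷ lca p q
lca-same k p q rewrite ≡ᵇ-refl k = refl

lca-differ : ∀ {a b} p q → a ≢ b → lca (a ∷ p) (b ∷ q) ≡ []
lca-differ p q ne rewrite ≢⇒≡ᵇ-false ne = refl

lca-[]ʳ : ∀ p → lca p [] ≡ []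
lca-[]ʳ [] = refl
lca-[]ʳ (_ ∷ _) = refl

adjacent : Cotree → Path → Path → Bool
adjacent t p q = isJoin (labelAt t (lca p q))

adjacentE : Cotree → WEdge Path → Bool
adjacentE t (p , q , _) = adjacent t p q

leafEdges : Cotree → List (WEdge Path)
leafEdges t = filterᵇ (adjacentE t) (unitPairs (leavesT t))

-- Recursion runs over the remaining children, whereas labels are looked up in the full node; this
-- expresses the remainder by addresses.
Suffix : List Cotree → ℕ → List Cotree → Set
Suffix full k ds = ∀ j p → subtreeAtF full (k + j) p ≡ subtreeAtF ds j p

suffix-head : ∀ {full k d ds} → Suffix full k (d ∷ ds) → ∀ p → subtreeAtF full k p ≡ subtreeAt d p
suffix-head {full} {k} s p = trans (cong (λ i → subtreeAtF full i p) (sym (+-identityʳ k))) (s 0 p)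

suffix-tail : ∀ {full k d ds} → Suffix full k (d ∷ ds) → Suffix full (suc k) ds
suffix-tail {full} {k} s j p = trans (cong (λ i → subtreeAtF full i p) (sym (+-suc k j))) (s (suc j) p)

mutual
  -- Two leaves below the same child have their `lca` inside that child; leaves of different
  -- children meet at the node itself and are adjacent iff it is a join.
  leafEdges-edgesT : ∀ {V : Set} (φ : Path → V) t → map (mapEdge φ) (leafEdges t) ↭ edgesT φ t
  leafEdges-edgesT φ leaf = ↭-refl
  leafEdges-edgesT φ (node l cs) = leafEdges-edgesF φ l cs 0 cs (λ _ _ → refl)

  leafEdges-edgesF : ∀ {V : Set} (φ : Path → V) l full k ds → Suffix full k ds →
    map (mapEdge φ) (filterᵇ (adjacentE (node l full)) (unitPairs (leavesF k ds)))
      ↭ edgesF φ (isJoinLabel l) k ds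
  leafEdges-edgesF φ l full k [] s = ↭-refl
  leafEdges-edgesF φ l full k (d ∷ ds) s =
    ↭-trans (↭-map⁺ (mapEdge φ) (filter-↭ (T? ∘ adj) (unitPairs-++ D rest)))
    (↭-trans (↭-reflexive (trans (cong (map (mapEdge φ)) split)
        (trans (map-++ (mapEdge φ) (filterᵇ adj (unitPairs D)) _)
          (cong (map (mapEdge φ) (filterᵇ adj (unitPairs D)) ++_) (map-++ (mapEdge φ) (filterᵇ adj (unitPairs rest)) _)))))
    (↭-++⁺ (↭-trans (↭-reflexive child) (leafEdges-edgesT (φ ∘ (k ∷_)) d))
      (↭-++⁺ (leafEdges-edgesF φ l full (suc k) ds (suffix-tail {full} {k} {d} {ds} s)) (↭-reflexive between))))
    where
    adj = adjacentE (node l full)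
    D = map (k ∷_) (leavesT d)
    rest = leavesF (suc k) ds
    b = isJoinLabel l
    split : filterᵇ adj (unitPairs D ++ unitPairs rest ++ cross D rest)
      ≡ filterᵇ adj (unitPairs D) ++ filterᵇ adj (unitPairs rest) ++ filterᵇ adj (cross D rest)
    split = trans (filter-++ (T? ∘ adj) (unitPairs D) _)
      (cong (filterᵇ adj (unitPairs D) ++_) (filter-++ (T? ∘ adj) (unitPairs rest) _))
    adj-child : ∀ e → adj (mapEdge (k ∷_) e) ≡ adjacentE d e
    adj-child (p , q , w) = cong isJoin (trans (cong (labelAt (node l full)) (lca-same k p q))
      (labelAt-cong (node l full) d (k ∷ lca p q) (lca p q) (suffix-head {full} {k} {d} {ds} s (lca p q))))
    child : map (mapEdge φ) (filterᵇ adj (unitPairs D)) ≡ map (mapEdge (φ ∘ (k ∷_))) (leafEdges d)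
    child = trans (cong (map (mapEdge φ))
        (trans (cong (filterᵇ adj) (sym (unitPairs-map (k ∷_) (leavesT d))))
          (trans (filterᵇ-map adj (mapEdge (k ∷_)) (unitPairs (leavesT d)))
            (cong (map (mapEdge (k ∷_))) (filterᵇ-cong (All.universal adj-child (unitPairs (leavesT d))))))))
      (sym (map-∘ (leafEdges d)))
    adj-between : ∀ xs {ys} → All (HeadFrom (suc k)) ys → All (λ e → adj e ≡ b) (cross (map (k ∷_) xs) ys)
    adj-between xs [] = []
    adj-between xs {_ ∷ _} ((a , q , refl , k<a) ∷ hs) = All.++⁺
      (All.map⁺ (All.map⁺ (All.universal (λ p → cong (isJoin ∘ labelAt (node l full)) (lca-differ p q (<⇒≢ k<a))) xs)))
      (adj-between xs hs)
    between : map (mapEdge φ) (filterᵇ adj (cross D rest))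
      ≡ cross (map (φ ∘ (k ∷_)) (leavesT d)) (opt b (map φ rest))
    between = trans (cong (map (mapEdge φ)) (trans (filterᵇ-cong (adj-between (leavesT d) (leavesF-head (suc k) ds)))
        (filterᵇ-const b (cross D rest))))
      (trans (opt-cross b) (cong (λ M → cross M (opt b (map φ rest))) (sym (map-∘ (leavesT d)))))
      where
      opt-cross : ∀ b → map (mapEdge φ) (opt b (cross D rest)) ≡ cross (map φ D) (opt b (map φ rest))
      opt-cross true = cross-map φ D rest
      opt-cross false = refl

-- Degrees of interior vertices

HeadBelow : ℕ → Path → Set
HeadBelow k v = ∃ λ a → ∃ λ p → v ≡ a ∷ p × a < k

-- The parent is either the root, when the leaf is its child, or still begins with `a`; in both
-- cases the paths part at the root.
lca-parent-differ : ∀ {a k} p w → a ≢ k → lca (parent (a ∷ p)) (k ∷ w) ≡ []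
lca-parent-differ [] w ne = refl
lca-parent-differ (b ∷ p) w ne = lca-differ (parent (b ∷ p)) w ne

-- Within a subtree `δ` sees only its own leaves; `W` supplies those outside.
vertexFactor : ℕ → Cotree → Path → ℕ
vertexFactor W t w = (W + δ t w) ^ (numChildren t w ∸ 1)

module _ (l : Label) (full : List Cotree) where
  private
    t = node l full
    b = isJoinLabel l

  counts : Path → Path → Bool
  counts w v = isJoin (labelAt t (lca (parent v) w))

  count-outside : ∀ {k} w vs → All (λ v → ∃ λ a → ∃ λ p → v ≡ a ∷ p × a ≢ k) vs →
    length (filterᵇ (counts (k ∷ w)) vs) ≡ scale b (length vs)
  count-outside {k} w vs hs = trans (cong length (trans (filterᵇ-cong (All.map outside hs)) (filterᵇ-const b vs)))
    (length-opt b vs)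
    where
    outside : ∀ {v} → (∃ λ a → ∃ λ p → v ≡ a ∷ p × a ≢ k) → counts (k ∷ w) v ≡ b
    outside (a , p , refl , ne) = cong (isJoin ∘ labelAt t) (lca-parent-differ p w ne)

  δ-root : δ t [] ≡ scale b (leafCount full)
  δ-root = trans (cong length (trans (filterᵇ-cong (All.universal root (leavesT t))) (filterᵇ-const b (leavesT t))))
    (trans (length-opt b (leavesT t)) (cong (scale b) (length-leavesF 0 full)))
    where
    root : ∀ v → counts [] v ≡ b
    root v = cong (isJoin ∘ labelAt t) (lca-[]ʳ (parent v))

  -- Leaves of the other children are compared with `w` at the root and count according to its
  -- label; those of `d` count as they do in `d`. Were `d` a leaf, the parent of its path would be
  -- the root and not a vertex of `d`; nonempty leaf paths exclude this.
  δ-child : ∀ k before d ds w → Suffix full k (d ∷ ds) → leavesF 0 full ≡ before ++ leavesF k (d ∷ ds) →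
    All (HeadBelow k) before → All (λ v → v ≢ []) (leavesT d) →
    δ t (k ∷ w) ≡ scale b (length before) + scale b (leafCount ds) + δ d w
  δ-child k before d ds w s e below nonempty = begin
      length (filterᵇ c (leavesF 0 full))   ≡⟨ cong (length ∘ filterᵇ c) e ⟩
      length (filterᵇ c (before ++ D ++ after))
        ≡⟨ cong length (trans (filter-++ (T? ∘ c) before _) (cong (filterᵇ c before ++_) (filter-++ (T? ∘ c) D after))) ⟩
      length (filterᵇ c before ++ filterᵇ c D ++ filterᵇ c after)
        ≡⟨ trans (length-++ (filterᵇ c before)) (cong (length (filterᵇ c before) +_) (length-++ (filterᵇ c D))) ⟩
      length (filterᵇ c before) + (length (filterᵇ c D) + length (filterᵇ c after))
        ≡⟨ cong₂ _+_ (count-outside w before (All.map (λ (a , p , q , r) → a , p , q , <⇒≢ r) below))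
             (cong₂ _+_ inside (trans (count-outside w after
                 (All.map (λ (a , p , q , r) → a , p , q , (λ a≡k → <⇒≢ r (sym a≡k))) (leavesF-head (suc k) ds)))
               (cong (scale b) (length-leavesF (suc k) ds)))) ⟩
      scale b (length before) + (δ d w + scale b (leafCount ds))
        ≡⟨ arith (scale b (length before)) (δ d w) (scale b (leafCount ds)) ⟩
      scale b (length before) + scale b (leafCount ds) + δ d w ∎
    where
    open ≡-Reasoning
    c = counts (k ∷ w)
    D = map (k ∷_) (leavesT d)
    after = leavesF (suc k) ds
    arith : ∀ x y z → x + (y + z) ≡ x + z + y
    arith = solve-∀
    below-k : ∀ {v} → v ≢ [] → c (k ∷ v) ≡ isJoin (labelAt d (lca (parent v) w))
    below-k {[]} ne = ⊥-elim (ne refl)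
    below-k {a ∷ v} _ = cong isJoin (trans (cong (labelAt t) (lca-same k (parent (a ∷ v)) w))
      (labelAt-cong t d (k ∷ lca (parent (a ∷ v)) w) (lca (parent (a ∷ v)) w)
        (suffix-head {full} {k} {d} {ds} s (lca (parent (a ∷ v)) w))))
    inside : length (filterᵇ c D) ≡ δ d w
    inside = trans (cong length (filterᵇ-map c (k ∷_) (leavesT d)))
      (trans (length-map (k ∷_) (filterᵇ (c ∘ (k ∷_)) (leavesT d))) (cong length (filterᵇ-cong (All.map below-k nonempty))))

mutual
  product-interiorsT : ∀ W t → product (map (vertexFactor W t) (interiorsT t)) ≡ degreeProduct W t
  product-interiorsT W leaf = refl
  product-interiorsT W (node l cs) = cong₂ _*_
    (cong (λ x → (W + x) ^ (length cs ∸ 1)) (δ-root l cs))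
    (product-interiorsF l cs W W 0 [] cs (λ _ _ → refl) refl [] (trans (cong (W +_) (scale-0 (isJoinLabel l))) (+-identityʳ W)))

  -- `W` lies outside the whole node, and `W'` also includes the earlier children if they are
  -- joined. It is a separate variable because `degreeProductF` accumulates that sum in another
  -- association.
  product-interiorsF : ∀ l full W W' k before ds → Suffix full k ds → leavesF 0 full ≡ before ++ leavesF k ds →
    All (HeadBelow k) before → W + scale (isJoinLabel l) (length before) ≡ W' →
    product (map (vertexFactor W (node l full)) (interiorsF k ds)) ≡ degreeProductF (isJoinLabel l) W' ds
  product-interiorsF l full W W' k before [] s e below W'≡ = refl
  product-interiorsF l full W W' k before (d ∷ ds) s e below W'≡ = begin
      product (map F (map (k ∷_) (interiorsT d) ++ interiorsF (suc k) ds))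
        ≡⟨ trans (cong product (map-++ F (map (k ∷_) (interiorsT d)) _)) (product-++ (map F (map (k ∷_) (interiorsT d))) _) ⟩
      product (map F (map (k ∷_) (interiorsT d))) * product (map F (interiorsF (suc k) ds))
        ≡⟨ cong₂ _*_ (trans (cong product (trans (sym (map-∘ (interiorsT d))) (child d s e)))
             (product-interiorsT (W' + scale b (leafCount ds)) d))
             (product-interiorsF l full W (W' + scale b (nV d)) (suc k) (before ++ D) ds (suffix-tail {full} {k} {d} {ds} s)
               (trans e (sym (++-assoc before D _)))
               (All.++⁺ (All.map (λ (a , p , q , r) → a , p , q , m≤n⇒m≤1+n r) below)
                 (All.map⁺ (All.universal (λ p → k , p , refl , n<1+n k) (leavesT d))))
               grow) ⟩
      degreeProduct (W' + scale b (leafCount ds)) d * degreeProductF b (W' + scale b (nV d)) ds ∎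
    where
    open ≡-Reasoning
    b = isJoinLabel l
    F = vertexFactor W (node l full)
    D = map (k ∷_) (leavesT d)
    grow : W + scale b (length (before ++ D)) ≡ W' + scale b (nV d)
    grow = trans (cong (W +_) (trans (cong (scale b) (trans (length-++ before) (cong (length before +_) (length-map (k ∷_) (leavesT d)))))
        (scale-+ b (length before) (nV d))))
      (trans (sym (+-assoc W _ _)) (cong (_+ scale b (nV d)) W'≡))
    child : ∀ d → Suffix full k (d ∷ ds) → leavesF 0 full ≡ before ++ leavesF k (d ∷ ds) →
      map (F ∘ (k ∷_)) (interiorsT d) ≡ map (vertexFactor (W' + scale b (leafCount ds)) d) (interiorsT d)
    child leaf _ _ = refl
    child d@(node l' cs') s e = map-cong (λ w → cong₂ (λ x y → x ^ (y ∸ 1))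
        (trans (cong (W +_) (δ-child l full k before d ds w s e below
            (All.map (λ { (a , p , refl , _) () }) (leavesF-head 0 cs'))))
          (trans (arith W _ (scale b (leafCount ds)) (δ d w)) (cong (λ x → x + scale b (leafCount ds) + δ d w) W'≡)))
        (numChildren-cong (node l full) d (k ∷ w) w (suffix-head {full} {k} {d} {ds} s w))) (interiorsT d)
      where
      arith : ∀ W x y z → W + (x + y + z) ≡ W + x + y + z
      arith = solve-∀

-- Filtered lists and unordered pairs

≡true⇒T : ∀ {b} → b ≡ true → Bool.T b
≡true⇒T refl = _

T⇒≡true : ∀ {b} → Bool.T b → b ≡ true
T⇒≡true {true} _ = refl

module _ {A : Set} where
  filterᵇ-filterᵇ : ∀ (p q : A → Bool) → (∀ x → p x ≡ true → q x ≡ true) → ∀ xs →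
    filterᵇ p (filterᵇ q xs) ≡ filterᵇ p xs
  filterᵇ-filterᵇ p q p⇒q [] = refl
  filterᵇ-filterᵇ p q p⇒q (x ∷ xs) with q x in eq
  ... | true with p x
  ...   | true = cong (x ∷_) (filterᵇ-filterᵇ p q p⇒q xs)
  ...   | false = filterᵇ-filterᵇ p q p⇒q xs
  filterᵇ-filterᵇ p q p⇒q (x ∷ xs) | false with p x in eq'
  ...   | true with trans (sym eq) (p⇒q x eq')
  ...     | ()
  filterᵇ-filterᵇ p q p⇒q (x ∷ xs) | false | false = filterᵇ-filterᵇ p q p⇒q xs

  -- A sublist is recovered from its membership test with its order, so edge sets can be represented
  -- by lists without passing to permutations.
  filterᵇ-sublist : ∀ (p : A → Bool) {xs ys} → Unique ys → xs ⊆ ys →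
    (∀ {y} → y ∈ ys → y ∈ xs → p y ≡ true) → (∀ {y} → y ∈ ys → y ∉ xs → p y ≡ false) →
    filterᵇ p ys ≡ xs
  filterᵇ-sublist p [] [] yes-p no-p = refl
  filterᵇ-sublist p {xs} {y ∷ ys} (y∉ ∷ u) (_ ∷ʳ s) yes-p no-p
    rewrite no-p (here refl) (λ y∈ → All.lookup y∉ (Any-resp-⊆ s y∈) refl) =
    filterᵇ-sublist p u s (yes-p ∘ there) (no-p ∘ there)
  filterᵇ-sublist p {x ∷ xs} {_ ∷ ys} (y∉ ∷ u) (refl ∷ s) yes-p no-p
    rewrite yes-p (here refl) (here refl) = cong (x ∷_)
    (filterᵇ-sublist p u s (λ y∈ y∈' → yes-p (there y∈) (there y∈'))
      (λ y∈ y∉' → no-p (there y∈) λ { (here refl) → All.lookup y∉ y∈ refl ; (there y∈') → y∉' y∈' }))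

  -- Meant for maps that are injective only on the listed elements: `toMatrix` forgets order and
  -- repetition, but can be inverted on sublists of `edges`.
  unique-map-retract : {B : Set} (h : A → B) (k : B → A) → ∀ {xs} → Unique xs → (∀ {x} → x ∈ xs → k (h x) ≡ x) →
    Unique (map h xs)
  unique-map-retract h k [] r = []
  unique-map-retract h k (x∉ ∷ u) r =
    All.map⁺ (All.tabulate (λ {y} y∈ e → All.lookup x∉ y∈
      (trans (sym (r (here refl))) (trans (cong k e) (r (there y∈)))))) ∷
    unique-map-retract h k u (r ∘ there)

  pairs : List A → List (A × A)
  pairs [] = []
  pairs (x ∷ xs) = map (x ,_) xs ++ pairs xs

  pairs-∈ : ∀ {xs x y} → (x , y) ∈ pairs xs → x ∈ xs × y ∈ xs
  pairs-∈ {z ∷ xs} e∈ with ∈-++⁻ (map (z ,_) xs) e∈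
  ... | inj₂ e∈' with pairs-∈ e∈'
  ...   | x∈ , y∈ = there x∈ , there y∈
  pairs-∈ {z ∷ xs} e∈ | inj₁ e∈' with ∈-map⁻ (z ,_) e∈'
  ...   | _ , y∈ , refl = here refl , there y∈

  pairs-related : {R : A → A → Set} → ∀ {xs} → AllPairs R xs → ∀ {x y} → (x , y) ∈ pairs xs → R x y
  pairs-related {xs = z ∷ xs} (r ∷ rs) e∈ with ∈-++⁻ (map (z ,_) xs) e∈
  ... | inj₂ e∈' = pairs-related rs e∈'
  ... | inj₁ e∈' with ∈-map⁻ (z ,_) e∈'
  ...   | _ , y∈ , refl = All.lookup r y∈

  pairs-unique : ∀ {xs} → Unique xs → Unique (pairs xs)
  pairs-unique [] = []
  pairs-unique {x ∷ xs} (x∉ ∷ u) = Unique.++⁺ (Unique.map⁺ Product.,-injectiveʳ u) (pairs-unique u)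
    (λ (e∈ , e∈') → disjoint e∈ e∈')
    where
    disjoint : ∀ {e} → e ∈ map (x ,_) xs → e ∉ pairs xs
    disjoint e∈ e∈' with ∈-map⁻ (x ,_) e∈
    ... | _ , _ , refl = All.lookup x∉ (proj₁ (pairs-∈ e∈')) refl

  pairs-complete : ∀ {xs x y} → x ∈ xs → y ∈ xs → x ≢ y → (x , y) ∈ pairs xs ⊎ (y , x) ∈ pairs xs
  pairs-complete (here refl) (here refl) ne = ⊥-elim (ne refl)
  pairs-complete (here refl) (there y∈) ne = inj₁ (∈-++⁺ˡ (∈-map⁺ (_ ,_) y∈))
  pairs-complete (there x∈) (here refl) ne = inj₂ (∈-++⁺ˡ (∈-map⁺ (_ ,_) x∈))
  pairs-complete {z ∷ xs} (there x∈) (there y∈) ne with pairs-complete x∈ y∈ ne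
  ... | inj₁ e∈ = inj₁ (∈-++⁺ʳ (map (z ,_) xs) e∈)
  ... | inj₂ e∈ = inj₂ (∈-++⁺ʳ (map (z ,_) xs) e∈)

weigh : {A : Set} → A × A → WEdge A
weigh (x , y) = x , y , 1

weigh-pairs : {A : Set} (xs : List A) → map weigh (pairs xs) ≡ unitPairs xs
weigh-pairs [] = refl
weigh-pairs (x ∷ xs) = trans (map-++ weigh (map (x ,_) xs) (pairs xs))
  (cong₂ _++_ (sym (map-∘ xs)) (weigh-pairs xs))

-- Counting the entries of a symmetric Boolean matrix

count : {A : Set} → (A → Bool) → List A → ℕ
count p xs = length (filterᵇ p xs)

module _ {A : Set} (h : A → A → Bool) (h-sym : ∀ x y → h x y ≡ h y x) (h-irrefl : ∀ x → h x x ≡ false) where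

  private
    column : List A → List A → ℕ
    column ys zs = sum (map (λ z → count (h z) ys) zs)

    arith : ∀ x z ys zs →
      count (h z) ys + (count (h x) zs + column ys zs) ≡ count (h x) zs + (count (h z) ys + column ys zs)
    arith x z ys zs = swap-first (count (h z) ys) (count (h x) zs) (column ys zs)
      where
      swap-first : ∀ a b c → a + (b + c) ≡ b + (a + c)
      swap-first = solve-∀

  count-column : ∀ x ys zs →
    column (x ∷ ys) zs ≡ count (h x) zs + column ys zs
  count-column x ys [] = refl
  count-column x ys (z ∷ zs) rewrite h-sym z x with h x z
  ... | true = cong suc (trans (cong (count (h z) ys +_) (count-column x ys zs)) (arith x z ys zs))
  ... | false = trans (cong (count (h z) ys +_) (count-column x ys zs)) (arith x z ys zs)

  -- The first row and first column of the square agree by symmetry and meet in a zero.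
  count-symmetric : ∀ xs → column xs xs ≡ 2 * count (uncurry h) (pairs xs)
  count-symmetric [] = refl
  count-symmetric (x ∷ xs) = begin
      count (h x) (x ∷ xs) + column (x ∷ xs) xs
        ≡⟨ cong₂ _+_ diagonal (trans (count-column x xs xs) (cong (count (h x) xs +_) (count-symmetric xs))) ⟩
      count (h x) xs + (count (h x) xs + 2 * count (uncurry h) (pairs xs))
        ≡⟨ double (count (h x) xs) (count (uncurry h) (pairs xs)) ⟩
      2 * (count (h x) xs + count (uncurry h) (pairs xs))
        ≡⟨ cong (λ k → 2 * (k + count (uncurry h) (pairs xs)))
             (trans (cong length (filterᵇ-map (uncurry h) (x ,_) xs)) (length-map (x ,_) (filterᵇ (h x) xs))) ⟨
      2 * (count (uncurry h) (map (x ,_) xs) + count (uncurry h) (pairs xs))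
        ≡⟨ cong (2 *_) (trans (cong length (filter-++ (T? ∘ uncurry h) (map (x ,_) xs) (pairs xs)))
             (length-++ (filterᵇ (uncurry h) (map (x ,_) xs)))) ⟨
      2 * count (uncurry h) (pairs (x ∷ xs)) ∎
    where
    open ≡-Reasoning
    diagonal : count (h x) (x ∷ xs) ≡ count (h x) xs
    diagonal rewrite h-irrefl x = refl
    double : ∀ a b → a + (a + 2 * b) ≡ 2 * (a + b)
    double = solve-∀

entry : ∀ {m n} → Vec (Vec Bool n) m → Fin m → Fin n → Bool
entry H i j = Vec.lookup (Vec.lookup H i) j

trues-count : ∀ {n} (v : Vec Bool n) → trues v ≡ count (Vec.lookup v) (allFin n)
trues-count [] = refl
trues-count {suc n} (b ∷ v) = by-head b
  where
  count-tail : ∀ b → count (Vec.lookup (b ∷ v)) (tabulate suc) ≡ count (Vec.lookup v) (allFin n)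
  count-tail b = trans (cong (count (Vec.lookup (b ∷ v))) (sym (map-tabulate id suc)))
    (trans (cong length (filterᵇ-map (Vec.lookup (b ∷ v)) suc (allFin n))) (length-map suc (filterᵇ (Vec.lookup v) (allFin n))))
  by-head : ∀ b → trues (b ∷ v) ≡ count (Vec.lookup (b ∷ v)) (allFin (suc n))
  by-head true = cong suc (trans (trues-count v) (sym (count-tail true)))
  by-head false = trans (trues-count v) (sym (count-tail false))

entries-count : ∀ {m n} (H : Vec (Vec Bool n) m) →
  entries H ≡ sum (map (λ i → count (entry H i) (allFin n)) (allFin m))
entries-count [] = refl
entries-count {suc m} {n} (r ∷ H) = cong₂ _+_ (trues-count r)
  (trans (entries-count H) (cong sum (trans (map-∘ (allFin m)) (cong (map _) (map-tabulate id suc)))))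

matrix-ext : ∀ {m n} (H K : Vec (Vec Bool n) m) → (∀ i j → entry H i j ≡ entry K i j) → H ≡ K
matrix-ext H K e = trans (sym (Vec.tabulate∘lookup H)) (trans
  (Vec.tabulate-cong (λ i → trans (sym (Vec.tabulate∘lookup _)) (trans (Vec.tabulate-cong (e i)) (Vec.tabulate∘lookup _))))
  (Vec.tabulate∘lookup K))

-- Enumeration of spanning trees

module Enumeration {C : Set} (_≟_ : DecidableEquality C) {n : ℕ} (origin : Fin n)
  (adj : Fin n → Fin n → Bool) (adj-sym : ∀ i j → adj i j ≡ adj j i) where
  open WeightedCount _≟_

  private
    V = Fin n
    vs = allFin n

  private variable
    f : V → C
    S E : List (V × V)

  edges : List (V × V)
  edges = filterᵇ (uncurry adj) (pairs vs)

  -- The recursion of `τ` at weight 1, listing edge sets instead of counting them. It remains to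
  -- recognise these sets as the spanning trees.
  trees : (V → C) → List (V × V) → List (List (V × V))
  trees f [] = if does (allEqual? (map f vs)) then [] ∷ [] else []
  trees f ((u , v) ∷ E) =
    trees f E ++ (if does (f u ≟ f v) then [] else map ((u , v) ∷_) (trees (contract f u v) E))

  length-trees : ∀ f E → length (trees f E) ≡ τ vs f (map weigh E)
  length-trees f [] with allEqual? (map f vs)
  ... | yes a = sym (τ-spanning a)
  ... | no ¬a = sym (τ-nonspanning ¬a)
  length-trees f ((u , v) ∷ E) with f u ≟ f v
  ... | yes e = trans (length-++ (trees f E)) (trans (+-identityʳ _) (trans (length-trees f E) (sym (τ-loop e))))
  ... | no ne = trans (length-++ (trees f E)) (trans
      (cong₂ _+_ (length-trees f E)
        (trans (length-map _ (trees (contract f u v) E)) (trans (length-trees (contract f u v) E) (sym (*-identityˡ _)))))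
      (sym (τ-edge ne)))

  -- Acyclicity in list order: each edge joins two classes that are still distinct, and at the end
  -- one class is left.
  data Tree : (V → C) → List (V × V) → Set where
    spanning : (∀ i j → f i ≡ f j) → Tree f []
    _∷_ : ∀ {u v} → f u ≢ f v → Tree (contract f u v) S → Tree f ((u , v) ∷ S)

  allEqual⇒constant : AllEqual (map f vs) → ∀ i j → f i ≡ f j
  allEqual⇒constant a i j = allEqual-lookup a (∈-allFin i) (∈-allFin j)

  constant⇒allEqual : (∀ i j → f i ≡ f j) → AllEqual (map f vs)
  constant⇒allEqual c = All.map⁺ (All.universal (λ i → All.map⁺ (All.universal (c i) vs)) vs)

  trees-sound : ∀ f E → S ∈ trees f E → S ⊆ E × Tree f S
  trees-sound f [] S∈ with allEqual? (map f vs)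
  trees-sound f [] (here refl) | yes a = [] , spanning (allEqual⇒constant a)
  trees-sound f [] () | no _
  trees-sound f ((u , v) ∷ E) S∈ with f u ≟ f v | ∈-++⁻ (trees f E) S∈
  ... | _ | inj₁ S∈' with trees-sound f E S∈'
  ...   | s , t = (u , v) ∷ʳ s , t
  trees-sound f ((u , v) ∷ E) S∈ | no ne | inj₂ S∈' with ∈-map⁻ ((u , v) ∷_) S∈'
  ...   | S' , S'∈ , refl with trees-sound (contract f u v) E S'∈
  ...     | s , t = refl ∷ s , ne ∷ t

  trees-complete : S ⊆ E → Tree f S → S ∈ trees f E
  trees-complete {f = f} [] (spanning c) rewrite dec-true (allEqual? (map f vs)) (constant⇒allEqual c) = here refl
  trees-complete {f = f} ((u , v) ∷ʳ s) t = ∈-++⁺ˡ (trees-complete s t)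
  trees-complete {E = _ ∷ E} {f = f} (_∷_ {x = u , v} refl s) (ne ∷ t) rewrite dec-false (f u ≟ f v) ne =
    ∈-++⁺ʳ (trees f E) (∈-map⁺ ((u , v) ∷_) (trees-complete s t))

  trees-unique : ∀ f E → Unique E → Unique (trees f E)
  trees-unique f [] _ with allEqual? (map f vs)
  ... | yes _ = [] ∷ []
  ... | no _ = []
  trees-unique f ((u , v) ∷ E) (e∉ ∷ uE) with f u ≟ f v
  ... | yes _ = Unique.++⁺ (trees-unique f E uE) [] λ ()
  ... | no _ = Unique.++⁺ (trees-unique f E uE)
      (Unique.map⁺ (λ { refl → refl }) (trees-unique (contract f u v) E uE)) (λ (S∈ , S∈') → disjoint S∈ S∈')
    where
    disjoint : ∀ {S} → S ∈ trees f E → S ∉ map ((u , v) ∷_) (trees (contract f u v) E)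
    disjoint S∈ S∈' with ∈-map⁻ ((u , v) ∷_) S∈'
    ... | S' , _ , refl = All.lookup e∉ (Any-resp-⊆ (proj₁ (trees-sound f E S∈)) (here refl)) refl

  -- The number of components is tracked through an explicit list of classes. Contracting a non-loop
  -- lowers it by one, which ties it to the number of edges.
  record Classes (f : V → C) (m : ℕ) : Set where
    field
      values    : List C
      distinct  : Unique values
      attained  : All (λ c → ∃ λ x → f x ≡ c) values
      exhaustive : ∀ x → f x ∈ values
      size      : length values ≡ m
  open Classes

  remove : C → List C → List C
  remove c = filter (λ d → ¬? (c ≟ d))

  length-remove : ∀ {c cs} → Unique cs → c ∈ cs → suc (length (remove c cs)) ≡ length cs
  length-remove {c} {_ ∷ cs} (c∉ ∷ u) (here refl) rewrite dec-true (c ≟ c) refl =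
    cong (suc ∘ length) (filter-all (λ d → ¬? (c ≟ d)) c∉)
  length-remove {c} {d ∷ cs} (d∉ ∷ u) (there c∈)
    rewrite dec-false (c ≟ d) (λ e → All.lookup d∉ c∈ (sym e)) = cong suc (length-remove u c∈)

  classes-contract : ∀ {u v m} → f u ≢ f v → Classes f (suc m) → Classes (contract f u v) m
  classes-contract {f} {u} {v} ne cl = record
    { values = remove (f v) (values cl)
    ; distinct = Unique.filter⁺ keep (distinct cl)
    ; attained = All.tabulate attained'
    ; exhaustive = exhaustive'
    ; size = suc-injective (trans (length-remove (distinct cl) (exhaustive cl v)) (size cl)) }
    where
    keep = λ d → ¬? (f v ≟ d)
    attained' : ∀ {c} → c ∈ remove (f v) (values cl) → ∃ λ x → contract f u v x ≡ c
    attained' c∈ with ∈-filter⁻ keep {xs = values cl} c∈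
    ... | c∈' , c≢ with All.lookup (attained cl) c∈'
    ...   | x , refl = x , contract-miss f (c≢ ∘ sym)
    exhaustive' : ∀ x → contract f u v x ∈ remove (f v) (values cl)
    exhaustive' x with f x ≟ f v
    ... | yes _ = ∈-filter⁺ keep (exhaustive cl u) (ne ∘ sym)
    ... | no ne' = ∈-filter⁺ keep (exhaustive cl x) (ne' ∘ sym)

  classes-constant : ∀ {m} → (∀ i j → f i ≡ f j) → Classes f m → m ≡ 1
  -- The vertex `origin` excludes an empty list of values.
  classes-constant {f} c cl with values cl | distinct cl | attained cl | exhaustive cl origin | size cl
  ... | _ ∷ [] | _ | _ | _ | refl = refl
  ... | _ ∷ _ ∷ _ | (ne ∷ _) ∷ _ | (x , p) ∷ (y , q) ∷ _ | _ | _ = ⊥-elim (ne (trans (sym p) (trans (c x y) q)))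

  classes-discrete : (∀ {i j} → f i ≡ f j → i ≡ j) → Classes f n
  classes-discrete {f} inj = record
    { values = map f vs
    ; distinct = Unique.map⁺ inj (Unique.allFin⁺ n)
    ; attained = All.map⁺ (All.universal (λ x → x , refl) vs)
    ; exhaustive = λ x → ∈-map⁺ f (∈-allFin x)
    ; size = trans (length-map f vs) (length-tabulate id) }

  classes-nonempty : ∀ {m} → Classes f m → ∃ λ m' → m ≡ suc m'
  classes-nonempty cl with values cl | exhaustive cl origin | size cl
  ... | _ ∷ cs | _ | refl = length cs , refl

  tree-size : ∀ {m} → Tree f S → Classes f m → m ≡ suc (length S)
  tree-size (spanning c) cl = classes-constant c cl
  tree-size (ne ∷ t) cl with classes-nonempty cl
  ... | m' , refl = cong suc (tree-size t (classes-contract ne cl))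

  -- The invariant is that vertices in one class of `f` are already related; contracting an edge
  -- related by `P` preserves it.
  tree-connects : (P : V → V → Set) → (∀ {x y} → P x y → P y x) → (∀ {x y z} → P x y → P y z → P x z) →
    (∀ {x y} → f x ≡ f y → P x y) → All (uncurry P) S → Tree f S → ∀ x y → P x y
  tree-connects P P-sym P-trans f⊆P [] (spanning c) x y = f⊆P (c x y)
  tree-connects {f} P P-sym P-trans f⊆P (puv ∷ ps) (_∷_ {u = u} {v} _ t) =
    tree-connects P P-sym P-trans merged ps t
    where
    merged : ∀ {x y} → contract f u v x ≡ contract f u v y → P x y
    merged e with contract-cases f u v e
    ... | inj₁ e' = f⊆P e'
    ... | inj₂ (inj₁ (p , q)) = P-trans (f⊆P p) (P-trans puv (f⊆P (sym q)))
    ... | inj₂ (inj₂ (p , q)) = P-trans (f⊆P p) (P-trans (P-sym puv) (f⊆P (sym q)))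

  -- Connectedness through colourings rather than walks: this form passes directly to contractions
  -- and survives the removal of loops.
  Connecting : (V → C) → List (V × V) → Set
  Connecting f S = ∀ g → f ≼ g → All (λ (u , v) → g u ≡ g v) S → ∀ x y → g x ≡ g y

  connecting-loop : ∀ {u v} → f u ≡ f v → Connecting f ((u , v) ∷ S) → Connecting f S
  connecting-loop {u = u} {v} e con g f≼g gS = con g f≼g (f≼g u v e ∷ gS)

  connecting-contract : ∀ {u v} → Connecting f ((u , v) ∷ S) → Connecting (contract f u v) S
  connecting-contract {f} {u = u} {v} con g c≼g gS =
    con g (≼-trans (contract-≽ f u v) c≼g) (c≼g u v (contract-join f u v) ∷ gS)

  connecting-size : ∀ {m} S → Connecting f S → Classes f m → m ≤ suc (length S)
  connecting-size [] con cl = ≤-reflexive (classes-constant (con _ ≼-refl []) cl)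
  connecting-size {f} ((u , v) ∷ S) con cl with f u ≟ f v
  ... | yes e = m≤n⇒m≤1+n (connecting-size S (connecting-loop e con) cl)
  ... | no ne with classes-nonempty cl
  ...   | m' , refl = s≤s (connecting-size S (connecting-contract con) (classes-contract ne cl))

  -- No edge can be a loop: dropping it would leave a connecting set below the minimal size given by
  -- `connecting-size`.
  connecting-tree : ∀ S → Connecting f S → Classes f (suc (length S)) → Tree f S
  connecting-tree [] con cl = spanning (con _ ≼-refl [])
  connecting-tree {f} ((u , v) ∷ S) con cl with f u ≟ f v
  ... | yes e = ⊥-elim (1+n≰n (connecting-size S (connecting-loop e con) cl))
  ... | no ne = ne ∷ connecting-tree S (connecting-contract con) (classes-contract ne cl)

  open DecMembership (Product.≡-dec (Fin._≟_ {n}) (Fin._≟_ {n})) using (_∈?_)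

  linked : List (V × V) → V → V → Bool
  linked S i j = does ((i , j) ∈? S) ∨ does ((j , i) ∈? S)

  toMatrix : List (V × V) → Vec (Vec Bool n) n
  toMatrix S = Vec.tabulate λ i → Vec.tabulate λ j → linked S i j

  fromMatrix : Vec (Vec Bool n) n → List (V × V)
  fromMatrix H = filterᵇ (uncurry (entry H)) edges

  entry-toMatrix : ∀ S i j → entry (toMatrix S) i j ≡ linked S i j
  entry-toMatrix S i j = trans (cong (λ r → Vec.lookup r j) (Vec.lookup∘tabulate _ i)) (Vec.lookup∘tabulate _ j)

  linked-true : ∀ S {i j} → (i , j) ∈ S ⊎ (j , i) ∈ S → linked S i j ≡ true
  linked-true S {i} {j} (inj₁ e) = cong (_∨ does ((j , i) ∈? S)) (dec-true ((i , j) ∈? S) e)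
  linked-true S {i} {j} (inj₂ e) =
    trans (cong (does ((i , j) ∈? S) ∨_) (dec-true ((j , i) ∈? S) e)) (∨-zeroʳ _)

  linked-cases : ∀ S i j → linked S i j ≡ true → (i , j) ∈ S ⊎ (j , i) ∈ S
  linked-cases S i j e with (i , j) ∈? S | (j , i) ∈? S
  ... | yes p | _ = inj₁ p
  ... | no _ | yes p = inj₂ p

  edges-sorted : ∀ {i j} → (i , j) ∈ edges → i Fin.< j
  edges-sorted e∈ = pairs-related {R = Fin._<_} {xs = vs} (AllPairs.tabulate⁺-< {f = id} id) (proj₁ (∈-filter⁻ (T? ∘ uncurry adj) {xs = pairs vs} e∈))

  edges-adj : ∀ {i j} → (i , j) ∈ edges → adj i j ≡ true
  edges-adj e∈ = T⇒≡true (proj₂ (∈-filter⁻ (T? ∘ uncurry adj) {xs = pairs vs} e∈))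

  edges-unique : Unique edges
  edges-unique = Unique.filter⁺ (T? ∘ uncurry adj) (pairs-unique (Unique.allFin⁺ n))

  edges-complete : ∀ {i j} → i ≢ j → adj i j ≡ true → (i , j) ∈ edges ⊎ (j , i) ∈ edges
  edges-complete {i} {j} ne a with pairs-complete (∈-allFin i) (∈-allFin j) ne
  ... | inj₁ e∈ = inj₁ (∈-filter⁺ (T? ∘ uncurry adj) e∈ (≡true⇒T a))
  ... | inj₂ e∈ = inj₂ (∈-filter⁺ (T? ∘ uncurry adj) e∈ (≡true⇒T (trans (adj-sym j i) a)))

  Adjacent : V → V → Set
  Adjacent i j = i ≢ j × adj i j ≡ true

  module _ (H : Vec (Vec Bool n) n) (sub : ∀ i j → Edge H i j → Adjacent i j)
    (H-sym : ∀ i j → Edge H i j → Edge H j i) where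

    entry-sym : ∀ i j → entry H i j ≡ entry H j i
    entry-sym i j with entry H i j in e | entry H j i in e'
    ... | true | true = refl
    ... | false | false = refl
    ... | true | false = trans (sym (H-sym i j e)) e'
    ... | false | true = sym (trans (sym (H-sym j i e')) e)

    entry-irrefl : ∀ i → entry H i i ≡ false
    entry-irrefl i with entry H i i in e
    ... | false = refl
    ... | true = ⊥-elim (proj₁ (sub i i e) refl)

    -- Every true entry is an adjacency of the graph, so filtering `edges` gives the same list as
    -- filtering all pairs.
    entries-fromMatrix : entries H ≡ 2 * length (fromMatrix H)
    entries-fromMatrix = trans (entries-count H) (trans (count-symmetric (entry H) entry-sym entry-irrefl vs)
      (cong (λ S → 2 * length S) (sym (filterᵇ-filterᵇ (uncurry (entry H)) (uncurry adj)
        (λ (i , j) e → proj₂ (sub i j e)) (pairs vs)))))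

    fromMatrix-complete : ∀ {i j} → Edge H i j → (i , j) ∈ fromMatrix H ⊎ (j , i) ∈ fromMatrix H
    fromMatrix-complete {i} {j} e with edges-complete (proj₁ (sub i j e)) (proj₂ (sub i j e))
    ... | inj₁ e∈ = inj₁ (∈-filter⁺ (T? ∘ uncurry (entry H)) e∈ (≡true⇒T e))
    ... | inj₂ e∈ = inj₂ (∈-filter⁺ (T? ∘ uncurry (entry H)) e∈ (≡true⇒T (H-sym i j e)))

    fromMatrix-sound : ∀ {i j} → (i , j) ∈ fromMatrix H → Edge H i j
    fromMatrix-sound e∈ = T⇒≡true (proj₂ (∈-filter⁻ (T? ∘ uncurry (entry H)) {xs = edges} e∈))

    toMatrix-fromMatrix : toMatrix (fromMatrix H) ≡ H
    toMatrix-fromMatrix = matrix-ext (toMatrix (fromMatrix H)) H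
      (λ i j → trans (entry-toMatrix (fromMatrix H) i j) (same i j))
      where
      same : ∀ i j → linked (fromMatrix H) i j ≡ entry H i j
      same i j with entry H i j in e
      ... | true = linked-true (fromMatrix H) (fromMatrix-complete e)
      ... | false with linked (fromMatrix H) i j in e'
      ...   | false = refl
      ...   | true with linked-cases (fromMatrix H) i j e'
      ...     | inj₁ p = trans (sym (fromMatrix-sound p)) e
      ...     | inj₂ p = trans (sym (H-sym j i (fromMatrix-sound p))) e

  fromMatrix-toMatrix : S ⊆ edges → fromMatrix (toMatrix S) ≡ S
  fromMatrix-toMatrix {S} s = filterᵇ-sublist (uncurry (entry (toMatrix S))) edges-unique s
    (λ {(i , j)} _ e∈ → trans (entry-toMatrix S i j) (linked-true S (inj₁ e∈)))
    (λ {(i , j)} e∈ e∉ → trans (entry-toMatrix S i j) (unlinked e∈ e∉))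
    where
    unlinked : ∀ {i j} → (i , j) ∈ edges → (i , j) ∉ S → linked S i j ≡ false
    unlinked {i} {j} e∈ e∉ with linked S i j in e
    ... | false = refl
    ... | true with linked-cases S i j e
    ...   | inj₁ p = ⊥-elim (e∉ p)
    -- Edges are listed with the smaller endpoint first, so the reversed pair cannot occur as well.
    ...   | inj₂ p = ⊥-elim (Fin.<-asym (edges-sorted e∈) (edges-sorted (Any-resp-⊆ s p)))

  module _ {f : V → C} (f-inj : ∀ {i j} → f i ≡ f j → i ≡ j) where

    toMatrix-spanning : S ⊆ edges → Tree f S → IsSpanningTree n Adjacent (toMatrix S)
    toMatrix-spanning {S} s t = record
      { subgraph = sub
      ; symmetric = H-sym
      ; edgeCount = trans (entries-fromMatrix (toMatrix S) sub H-sym) (cong (2 *_)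
          (trans (cong length (fromMatrix-toMatrix s)) (cong (_∸ 1) (sym (tree-size t (classes-discrete f-inj))))))
      ; connected = tree-connects (Star (Edge (toMatrix S))) (reverse (H-sym _ _)) _◅◅_
          (λ e → subst (Star (Edge (toMatrix S)) _) (f-inj e) ε)
          (All.tabulate (λ {(i , j)} e∈ → trans (entry-toMatrix S i j) (linked-true S (inj₁ e∈)) ◅ ε)) t }
      where
      cases : ∀ {i j} → Edge (toMatrix S) i j → (i , j) ∈ S ⊎ (j , i) ∈ S
      cases {i} {j} e = linked-cases S i j (trans (sym (entry-toMatrix S i j)) e)
      sub : ∀ i j → Edge (toMatrix S) i j → Adjacent i j
      sub i j e with cases e
      ... | inj₁ p = let p' = Any-resp-⊆ s p in (λ i≡j → Fin.<-irrefl i≡j (edges-sorted p')) , edges-adj p'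
      ... | inj₂ p = let p' = Any-resp-⊆ s p in
        (λ i≡j → Fin.<-irrefl (sym i≡j) (edges-sorted p')) , trans (adj-sym i j) (edges-adj p')
      H-sym : ∀ i j → Edge (toMatrix S) i j → Edge (toMatrix S) j i
      H-sym i j e with cases e
      ... | inj₁ p = trans (entry-toMatrix S j i) (linked-true S (inj₂ p))
      ... | inj₂ p = trans (entry-toMatrix S j i) (linked-true S (inj₁ p))

    fromMatrix-tree : ∀ H → IsSpanningTree n Adjacent H → Tree f (fromMatrix H)
    fromMatrix-tree H st = connecting-tree (fromMatrix H) con (subst (Classes f) n≡ (classes-discrete f-inj))
      where
      open IsSpanningTree st
      con : Connecting f (fromMatrix H)
      con g _ gS x y = walk (connected x y)
        where
        step : ∀ {i j} → Edge H i j → g i ≡ g j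
        step e with fromMatrix-complete H subgraph symmetric e
        ... | inj₁ p = All.lookup gS p
        ... | inj₂ p = sym (All.lookup gS p)
        walk : ∀ {i j} → Star (Edge H) i j → g i ≡ g j
        walk ε = refl
        walk (e ◅ es) = trans (step e) (walk es)
      -- The subtraction in `edgeCount` truncates at 0; having a vertex makes it exact.
      positive : ∀ {n} → Fin n → n ≡ suc (n ∸ 1)
      positive {suc n} _ = refl
      n≡ : n ≡ suc (length (fromMatrix H))
      n≡ = trans (positive origin) (cong suc (*-cancelˡ-≡ _ _ 2
        (trans (sym edgeCount) (entries-fromMatrix H subgraph symmetric))))

    numSpanningTrees : NumSpanningTrees n Adjacent (τ vs f (map weigh edges))
    numSpanningTrees = map toMatrix (trees f edges)
      , unique-map-retract toMatrix fromMatrix (trees-unique f edges edges-unique)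
          (λ S∈ → fromMatrix-toMatrix (proj₁ (trees-sound f edges S∈)))
      , (λ H → mk⇔ (to H) (from H))
      , trans (length-map toMatrix (trees f edges)) (length-trees f edges)
      where
      to : ∀ H → H ∈ map toMatrix (trees f edges) → IsSpanningTree n Adjacent H
      to H H∈ with ∈-map⁻ toMatrix H∈
      ... | S , S∈ , refl with trees-sound f edges S∈
      ...   | s , t = toMatrix-spanning s t
      from : ∀ H → IsSpanningTree n Adjacent H → H ∈ map toMatrix (trees f edges)
      from H st = subst (_∈ map toMatrix (trees f edges))
        (toMatrix-fromMatrix H (IsSpanningTree.subgraph st) (IsSpanningTree.symmetric st))
        (∈-map⁺ toMatrix (trees-complete (filter-⊆ (T? ∘ uncurry (entry H)) edges) (fromMatrix-tree H st)))

-- From numbered vertices to leaf paths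

_≟ₚ_ : DecidableEquality Path
_≟ₚ_ = ≡-dec ℕ._≟_

module _ {C : Set} (_≟_ : DecidableEquality C) where
  open WeightedCount _≟_

  -- Contraction commutes with precomposition by `φ` definitionally. This moves the count from
  -- `Fin n`, where trees are enumerated, to paths, where modules live.
  τ-map : ∀ {V W : Set} (φ : V → W) vs (f : W → C) E → τ vs (f ∘ φ) E ≡ τ (map φ vs) f (map (mapEdge φ) E)
  τ-map φ vs f [] with allEqual? (map f (map φ vs))
  ... | yes a = trans (τ-spanning (subst AllEqual (sym (map-∘ vs)) a)) (sym (τ-spanning a))
  ... | no ¬a = trans (τ-nonspanning (¬a ∘ subst AllEqual (map-∘ vs))) (sym (τ-nonspanning ¬a))
  τ-map φ vs f ((u , v , w) ∷ E) with f (φ u) ≟ f (φ v)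
  ... | yes e = trans (τ-loop e) (trans (τ-map φ vs f E) (sym (τ-loop e)))
  ... | no ne = trans (τ-edge ne) (trans
      (cong₂ (λ x y → x + w * y) (τ-map φ vs f E) (τ-map φ vs (contract f (φ u) (φ v)) E))
      (sym (τ-edge ne)))

mutual
  leavesT-unique : ∀ t → Unique (leavesT t)
  leavesT-unique leaf = [] ∷ []
  leavesT-unique (node l cs) = leavesF-unique 0 cs

  leavesF-unique : ∀ k cs → Unique (leavesF k cs)
  leavesF-unique k [] = []
  leavesF-unique k (c ∷ cs) = Unique.++⁺ (Unique.map⁺ ∷-injectiveʳ (leavesT-unique c)) (leavesF-unique (suc k) cs)
    (λ (p∈ , p∈') → disjoint p∈ p∈')
    where
    disjoint : ∀ {p} → p ∈ map (k ∷_) (leavesT c) → p ∉ leavesF (suc k) cs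
    disjoint p∈ p∈' with ∈-map⁻ (k ∷_) p∈ | All.lookup (leavesF-head (suc k) cs) p∈'
    ... | q , _ , refl | _ , _ , refl , k<a = ℕ.<-irrefl refl k<a

lookup-injective : ∀ {A : Set} {xs : List A} → Unique xs → ∀ {i j} → lookup xs i ≡ lookup xs j → i ≡ j
lookup-injective (x∉ ∷ u) {zero} {zero} e = refl
lookup-injective {xs = _ ∷ xs} (x∉ ∷ u) {zero} {suc j} e = ⊥-elim (All.lookup x∉ (∈-lookup {xs = xs} j) e)
lookup-injective {xs = _ ∷ xs} (x∉ ∷ u) {suc i} {zero} e = ⊥-elim (All.lookup x∉ (∈-lookup {xs = xs} i) (sym e))
lookup-injective (x∉ ∷ u) {suc i} {suc j} e = cong suc (lookup-injective u e)

module _ where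
  open WeightedCount _≟ₚ_

  -- The whole vertex set is a module with no outside neighbours. Merging it costs
  -- `degreeProduct 0 T / n`, and this division lowers the exponent of `n` from one less to two less
  -- than the number of children of the root.
  τ-cotree : ∀ cs → WellFormed (node join cs) →
    let T = node join cs in τ (leavesT T) id (leafEdges T) ≡ formula T
  -- With at least two children the `∸ 2` in `formula` does not truncate.
  τ-cotree (_ ∷ []) (nodeWF (s≤s ()) _ _)
  τ-cotree cs@(c ∷ c' ∷ cs') wf = *-cancelˡ-≡ _ _ n {{∈⇒nonZero element-∈}} (begin
      n * τ vs id (leafEdges T)
        ≡⟨ cong (n *_) (≈-at vs (≈-perm vs (subst (_↭ edgesT id T) (map-id (leafEdges T)) (leafEdges-edgesT id T)))) ⟩
      n * τ vs id E            ≡⟨ cong (λ F → n * τ vs id F) (++-identityʳ E) ⟨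
      n * τ vs id (E ++ [])    ≡⟨ merge-count (All.tabulate id) [] (λ _ e → e) (merge-merges element-∈ (λ _ e → e)) [] [] ⟩
      degreeProduct 0 T * τ vs g (E ++ [])
        -- Once everything is merged all edges are loops, and a single class has exactly one
        -- spanning tree, the empty one.
        ≡⟨ cong (degreeProduct 0 T *_) (trans (≈-at vs (≈-loops (_∈ vs) together' inside)) (τ-spanning constant)) ⟩
      degreeProduct 0 T * 1    ≡⟨ *-identityʳ _ ⟩
      degreeProduct 0 T
        -- The root is a join with nothing outside, so its degree is the number of all leaves.
        ≡⟨ cong₂ (λ x y → x ^ suc (length cs') * y) (sym (length-leavesF 0 cs))
             (sym (product-interiorsF join cs 0 0 0 [] cs (λ _ _ → refl) refl [] refl)) ⟩
      n * n ^ length cs' * product (map (vertexFactor 0 T) (interiorsF 0 cs))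
        ≡⟨ arith n (n ^ length cs') (product (map (vertexFactor 0 T) (interiorsF 0 cs))) ⟩
      n * formula T ∎)
    where
    open ≡-Reasoning
    T = node join cs
    vs = leavesT T
    n = nV T
    E = edgesT id T
    open Modules _≟ₚ_ vs
    whole : Module vs E (λ W → degreeProduct W T)
    whole = resp-module _≟ₚ_ vs (map-id vs) refl (λ _ → refl) (tree-module _≟ₚ_ vs {φ = id} id T wf)
    open Module whole
    merged : Merges id vs (merge id element vs)
    merged = merge-merges element-∈ (λ _ e → e)
    g : Path → Path
    g = merge id element vs
    together' : ∀ {x y} → x ∈ vs → y ∈ vs → g x ≡ g y
    together' = Merges.together merged
    constant : AllEqual (map g vs)
    constant = All.map⁺ (All.tabulate (λ x∈ → All.map⁺ (All.tabulate (together' x∈))))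
    arith : ∀ n x p → n * x * p ≡ n * (p * x)
    arith = solve-∀

lca-comm : ∀ p q → lca p q ≡ lca q p
lca-comm [] [] = refl
lca-comm [] (_ ∷ _) = refl
lca-comm (_ ∷ _) [] = refl
lca-comm (a ∷ p) (b ∷ q) with a ℕ.≟ b
... | yes refl = trans (lca-same a p q) (trans (cong (a ∷_) (lca-comm p q)) (sym (lca-same a q p)))
... | no ne = trans (lca-differ p q ne) (sym (lca-differ q p (ne ∘ sym)))

isJoin-true : ∀ {l} → isJoin l ≡ true → l ≡ just join
isJoin-true {just join} _ = refl
isJoin-true {just union} ()
isJoin-true {nothing} ()

map-subgraph : ∀ {n} {A B : Fin n → Fin n → Set} → (∀ i j → A i j → B i j) → ∀ {H} →
  IsSpanningTree n A H → IsSpanningTree n B H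
map-subgraph A⇒B st = record
  { subgraph = λ i j e → A⇒B i j (subgraph i j e)
  ; symmetric = symmetric ; edgeCount = edgeCount ; connected = connected }
  where open IsSpanningTree st

numSpanningTrees-resp : ∀ {n} {A B : Fin n → Fin n → Set} {N} → (∀ i j → A i j → B i j) → (∀ i j → B i j → A i j) →
  NumSpanningTrees n A N → NumSpanningTrees n B N
numSpanningTrees-resp A⇒B B⇒A (L , u , mem , len) = L , u ,
  (λ H → mk⇔ (map-subgraph A⇒B ∘ Equivalence.to (mem H)) (Equivalence.from (mem H) ∘ map-subgraph B⇒A)) , len

map-lookup-allFin : ∀ {A : Set} (xs : List A) → map (lookup xs) (allFin (length xs)) ≡ xs
map-lookup-allFin xs = trans (map-tabulate id (lookup xs)) (tabulate-lookup xs)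

someLeaf : ∀ t → WellFormed t → Fin (nV t)
someLeaf leaf _ = zero
someLeaf (node l (c ∷ cs)) (nodeWF _ _ (w ∷ _)) with leavesT c | someLeaf c w
... | _ ∷ _ | _ = zero

theorem4p1 : (T : Cotree) → WellFormed T → labelAt T [] ≡ just join →
    NumSpanningTrees (nV T) (Adj T) (formula T)
theorem4p1 (node union cs) wf ()
theorem4p1 T@(node join cs) wf _ =
  subst (NumSpanningTrees (nV T) (Adj T)) count≡
    (numSpanningTrees-resp
      (λ i j (ne , a) → ne , isJoin-true a) (λ i j (ne , a) → ne , cong isJoin a)
      (numSpanningTrees (lookup-injective (leavesT-unique T))))
  where
  open WeightedCount _≟ₚ_
  adj : Fin (nV T) → Fin (nV T) → Bool
  adj i j = adjacent T (vtx T i) (vtx T j)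
  open Enumeration _≟ₚ_ (someLeaf T wf) adj
    (λ i j → cong (isJoin ∘ labelAt T) (lca-comm (vtx T i) (vtx T j)))
  open ≡-Reasoning
  vs = allFin (nV T)
  mapped-edges : map (mapEdge (vtx T)) (map weigh edges) ≡ leafEdges T
  mapped-edges = begin
    map (mapEdge (vtx T)) (map weigh edges)
      ≡⟨ cong (map (mapEdge (vtx T))) (filterᵇ-map (adjacentE T ∘ mapEdge (vtx T)) weigh (pairs vs)) ⟨
    map (mapEdge (vtx T)) (filterᵇ (adjacentE T ∘ mapEdge (vtx T)) (map weigh (pairs vs)))
      ≡⟨ filterᵇ-map (adjacentE T) (mapEdge (vtx T)) (map weigh (pairs vs)) ⟨
    filterᵇ (adjacentE T) (map (mapEdge (vtx T)) (map weigh (pairs vs)))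
      ≡⟨ cong (filterᵇ (adjacentE T)) (trans (cong (map (mapEdge (vtx T))) (weigh-pairs vs))
           (trans (unitPairs-map (vtx T) vs) (cong unitPairs (map-lookup-allFin (leavesT T))))) ⟩
    leafEdges T ∎
  count≡ : τ vs (vtx T) (map weigh edges) ≡ formula T
  count≡ = begin
    τ vs (vtx T) (map weigh edges)       ≡⟨ τ-map _≟ₚ_ (vtx T) vs id (map weigh edges) ⟩
    τ (map (vtx T) vs) id (map (mapEdge (vtx T)) (map weigh edges))
      ≡⟨ cong₂ (λ xs E → τ xs id E) (map-lookup-allFin (leavesT T)) mapped-edges ⟩
    τ (leavesT T) id (leafEdges T)       ≡⟨ τ-cotree cs wf ⟩
    formula T ∎
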